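{- For each integer $k \geq 2$ one has $$F(k) = k + \lfloor \sqrt{2k-3} \rfloor + \epsilon_k,$$ where $\epsilon_k \in \{ -1,0\}$, and where $F(k)$ denotes the maximum length of a $k$-separator, i.e. the largest $n \geq k$ for which there exists a permutation $\sigma \in S_n$ that is a $k$-separator.
   Context: For a positive integer $n$, $[n]=\{1,\dots,n\}$, and $S_n$ is the set of permutations of $[n]$, regarded as bijections $\sigma:[n]\to[n]$ and written $\sigma=\sigma_1\sigma_2\cdots\sigma_n$ with $\sigma_i=\sigma(i)$; $n$ is called the length of $\sigma$. Let $k \leq n$ be positive integers, $\sigma\in S_n$ and $\pi\in S_k$. A copy of the pattern $\pi$ in $\sigma$ is a $k$-tuple $(a_1,\dots,a_k)$ with $1\leq a_1<a_2<\cdots<a_k\leq n$ such that $\operatorname{sign}(\sigma_{a_j}-\sigma_{a_i})=\operatorname{sign}(\pi_j-\pi_i)$ for all $1\leq i<j\leq k$. Two copies are different if the corresponding $k$-tuples of positions $(a_1,\dots,a_k)$ are different. For $k\leq n$, a permutation $\sigma\in S_n$ is called a $k$-separator if it contains at most one copy of any $\pi\in S_k$ (equivalently, distinct $k$-element sets of positions in $\sigma$ give distinct patterns in $S_k$). -}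

module Defs where

open import Data.Fin.Base using (Fin; toℕ; _<_)
open import Data.Fin.Permutation using (Permutation′; _⟨$⟩ʳ_)
open import Data.Integer.Base using (ℤ; +_; _-_; sign)
open import Data.Nat.Base as ℕ using (ℕ; zero; suc; _≤_; z≤n; s≤s)
import Data.Nat.Properties as ℕ
open import Data.Product.Base using (_×_; _,_; ∃)
open import Data.Sign.Base using (Sign)
open import Level using (Level)
open import Relation.Binary.Core using (_Preserves_⟶_)
open import Relation.Binary.PropositionalEquality using (_≡_; _≗_)
open import Relation.Nullary.Decidable.Core using (yes; no)

private
  variable
    ℓ : Level
    k n : ℕ

-- [n] is represented by Fin n, so positions and values are numbered from 0.

-- The sign of σ_j − σ_i.  The library's two-valued sign sends 0 to +, but
-- only i < j is ever considered, and then σ_j ≢ σ_i as σ is a bijection.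
signOfDifference : Permutation′ n → Fin n → Fin n → Sign
signOfDifference σ i j = sign (+ toℕ (σ ⟨$⟩ʳ j) - + toℕ (σ ⟨$⟩ʳ i))

record IsCopy (π : Permutation′ k) (σ : Permutation′ n)
              (a : Fin k → Fin n) : Set where
  field
    increasing : a Preserves _<_ ⟶ _<_
    sameSigns  : ∀ i j → i < j →
                 signOfDifference σ (a i) (a j) ≡ signOfDifference π i j

-- Tuples of positions are functions, hence compared pointwise.
AtMostOneCopy : Permutation′ k → Permutation′ n → Set
AtMostOneCopy π σ = ∀ a b → IsCopy π σ a → IsCopy π σ b → a ≗ b

IsSeparator : (k : ℕ) → Permutation′ n → Set
IsSeparator {n} k σ = k ≤ n × (∀ (π : Permutation′ k) → AtMostOneCopy π σ)

IsSeparatorLength : ℕ → ℕ → Set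
IsSeparatorLength k n = ∃ λ (σ : Permutation′ n) → IsSeparator k σ

IsLargest : (ℕ → Set ℓ) → ℕ → Set ℓ
IsLargest P n = P n × (∀ m → P m → m ≤ n)

-- "F(k) = n"; a largest element is unique, so this relation is the graph of F.
IsMaxSeparatorLength : ℕ → ℕ → Set
IsMaxSeparatorLength k = IsLargest (IsSeparatorLength k)

-- ⌊√ (m + 1) ⌋ in terms of r = ⌊√ m ⌋: it increases by one exactly when m + 1
-- reaches the next square.
√-step : ℕ → ℕ → ℕ
√-step m r with suc r ℕ.* suc r ℕ.≤? suc m
... | yes _ = suc r
... | no  _ = r

⌊√_⌋ : ℕ → ℕ
⌊√ zero ⌋  = 0
⌊√ suc m ⌋ = √-step m ⌊√ m ⌋

IsFloorSqrt : ℕ → ℕ → Set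
IsFloorSqrt m r = r ℕ.* r ≤ m × m ℕ.< suc r ℕ.* suc r

√-step-spec : ∀ m r → IsFloorSqrt m r → IsFloorSqrt (suc m) (√-step m r)
√-step-spec m r (r²≤m , m<[1+r]²) with suc r ℕ.* suc r ℕ.≤? suc m
... | yes [1+r]²≤ = [1+r]²≤ ,
  ℕ.≤-<-trans m<[1+r]² (ℕ.*-mono-< (ℕ.n<1+n (suc r)) (ℕ.n<1+n (suc r)))
... | no  [1+r]²≰ = ℕ.m≤n⇒m≤1+n r²≤m , ℕ.≰⇒> [1+r]²≰

⌊√⌋-spec : ∀ m → IsFloorSqrt m ⌊√ m ⌋
⌊√⌋-spec zero    = z≤n , s≤s z≤n
⌊√⌋-spec (suc m) = √-step-spec m ⌊√ m ⌋ (⌊√⌋-spec m)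

{-# OPTIONS --safe #-}
-- Let d = n − k and s = d + 2.  A permutation of length n is a k-separator exactly
-- when any two of its points (i , σ i) are at ℓ¹-distance at least s.
--
-- If two points are closer, at most d − 1 points lie strictly between them in
-- position or in value; once these are deleted, deleting one or the other of the
-- two points leaves the same pattern.  Conversely, two different copies a, b of a
-- pattern match a i with b i, and iterating this matching gives monotone chains,
-- which start at points missed by b, so that there are at most d of them.  Within the
-- span of one step every chain has at most one point, and this yields two points
-- between whose positions and between whose values lie in total fewer than d points.
--
-- Distance s forces (s − 1)² + 2 ≤ 2 n, because the values in the first s
-- positions carry disjoint intervals, the i-th of half-length s − |2 i − (s − 1)|;
-- this reads d² ≤ 2 k − 3.  On the other hand s² ≤ 2 n suffices for distance s, by
-- sorting the multiples of a suitable residue; this covers d = ⌊√(2 k − 3)⌋ − 1.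
-- Whether d = ⌊√(2 k − 3)⌋ also occurs is decided by a finite search.
module Submission where

open import Defs
import Algebra.Properties.CommutativeMonoid.Sum as CommutativeMonoidSum
open import Data.Bool.Base using (true)
open import Data.Empty using (⊥; ⊥-elim)
open import Data.Fin.Base as Fin
  using (Fin; zero; suc; toℕ; fromℕ<; join; opposite; punchIn; punchOut; splitAt; _↑ʳ_)
open import Data.Fin.Permutation as Permutation
  using (Permutation′; permutation; reverse; inverseˡ; inverseʳ; _∘ₚ_; _⟨$⟩ʳ_; _⟨$⟩ˡ_)
import Data.Fin.Properties as Fin
open import Data.Fin.Subset using (Subset; ∣_∣; _∈_; _⊂_)
import Data.Fin.Subset.Properties as Subset
open import Data.Integer.Base as ℤ using (+_; -1ℤ; 0ℤ; sign)
import Data.Integer.Properties as ℤ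
open import Data.List.Base as List using (List; []; _∷_; _++_; length)
import Data.List.Properties as List
open import Data.List.Relation.Unary.All as All using (All; []; _∷_)
import Data.List.Relation.Unary.All.Properties as All
open import Data.Nat.Base
open import Data.Nat.Divisibility using (_∣_; ∣m+n∣m⇒∣n; ∣⇒≤; n∣m*n)
open import Data.Nat.DivMod
open import Data.Nat.Properties
open import Data.Nat.Tactic.RingSolver using (solve-∀)
open import Data.Product.Base using (_×_; _,_; ∃; ∃-syntax; proj₁; proj₂)
open import Data.Sign.Base using (Sign)
open import Data.Sum.Base using (_⊎_; inj₁; inj₂; [_,_]′)
import Data.Vec.Base as Vec
import Data.Vec.Properties as Vec
open import Function.Base using (_∘_; case_of_)
open import Function.Definitions using (Injective)
open import Relation.Binary.Definitions using (tri<; tri≈; tri>)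
open import Relation.Binary.PropositionalEquality
open import Relation.Nullary
open import Relation.Nullary.Decidable using (dec-true; map′; _×-dec_; _→-dec_; ¬?)
open import Relation.Unary using (Decidable)

open CommutativeMonoidSum +-0-commutativeMonoid using (sum; sum-permute; sum-cong-≗)

private
  variable
    k n d : ℕ

-- Linear arithmetic: a consequence A ≤ B of L ≤ R, with slack c, is certified by a
-- semiring identity.
≤-from : ∀ {L R A B} c → L ≤ R → A + R + c ≡ B + L → A ≤ B
≤-from {L} {R} {A} {B} c L≤R eq = +-cancelʳ-≤ R A B (begin
  A + R      ≤⟨ m≤m+n (A + R) c ⟩
  A + R + c  ≡⟨ eq ⟩
  B + L      ≤⟨ +-monoʳ-≤ B L≤R ⟩
  B + R      ∎)
  where open ≤-Reasoning

-- Injections, ranks and counting in finite sets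

injective⇒surjective : (f : Fin n → Fin n) → Injective _≡_ _≡_ f → ∀ y → ∃ λ x → f x ≡ y
injective⇒surjective {suc n} f f-inj y with Fin.any? (λ x → f x Fin.≟ y)
... | yes hit = hit
-- A missed value `y` could be punched out, which would inject `Fin (suc n)` into `Fin n`.
... | no miss = ⊥-elim (1+n≰n (Fin.injective⇒≤ {f = λ x → punchOut (y≢f x)}
                  (λ eq → f-inj (Fin.punchOut-injective (y≢f _) (y≢f _) eq))))
  where
  y≢f : ∀ x → y ≢ f x
  y≢f x eq = miss (x , sym eq)

injective⇒permutation : (f : Fin n → Fin n) → Injective _≡_ _≡_ f →
                        ∃ λ (π : Permutation′ n) → ∀ i → π ⟨$⟩ʳ i ≡ f i
injective⇒permutation f f-inj =
  permutation f (proj₁ ∘ f-surj) (proj₂ ∘ f-surj) (λ x → f-inj (proj₂ (f-surj (f x)))) , λ _ → refl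
  where f-surj = injective⇒surjective f f-inj

mono⇒reflects-< : (f g : Fin k → ℕ) → Injective _≡_ _≡_ f →
                  (∀ {i j} → f i < f j → g i < g j) → ∀ {i j} → g i < g j → f i < f j
mono⇒reflects-< f g f-inj mono {i} {j} gi<gj with <-cmp (f i) (f j)
... | tri< fi<fj _ _ = fi<fj
... | tri≈ _ eq _ = contradiction gi<gj (<-irrefl (cong g (f-inj eq)))
... | tri> _ _ fj<fi = contradiction (mono fj<fi) (<-asym gi<gj)

module _ (h : Fin k → ℕ) where

  private
    below : Fin k → Subset k
    below i = Vec.tabulate (λ j → does (h j <? h i))

    ∈-below : ∀ {i j} → h j < h i → j ∈ below i
    ∈-below {i} {j} lt = Vec.lookup⇒[]= j (below i)
      (trans (Vec.lookup∘tabulate _ j) (dec-true (h j <? h i) lt))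

    below-∈ : ∀ {i j} → j ∈ below i → h j < h i
    below-∈ {i} {j} j∈ = fromDoes (h j <? h i)
      (trans (sym (Vec.lookup∘tabulate _ j)) (Vec.[]=⇒lookup j∈))
      where
      fromDoes : ∀ {A : Set} (A? : Dec A) → does A? ≡ true → A
      fromDoes (yes a) _ = a

    below-⊂ : ∀ {i j} → h i < h j → below i ⊂ below j
    below-⊂ {i} lt = (λ x∈ → ∈-below (<-trans (below-∈ x∈) lt)) ,
      i , ∈-below lt , λ i∈ → <-irrefl refl (below-∈ i∈)

  -- Counts the smaller entries; `i` is not below itself, so there are fewer than `k` of them.
  rank : Fin k → Fin k
  rank i = fromℕ< (subst (∣ below i ∣ <_) (Subset.∣⊤∣≡n k)
    (Subset.p⊂q⇒∣p∣<∣q∣ ((λ _ → Subset.∈⊤) , i , Subset.∈⊤ , λ i∈ → <-irrefl refl (below-∈ i∈))))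

  rank-mono : ∀ {i j} → h i < h j → toℕ (rank i) < toℕ (rank j)
  rank-mono lt = subst₂ _<_ (sym (Fin.toℕ-fromℕ< _)) (sym (Fin.toℕ-fromℕ< _))
    (Subset.p⊂q⇒∣p∣<∣q∣ (below-⊂ lt))

-- The pattern of the sequence `h`: replacing every entry by its rank keeps the order.
standardize : (h : Fin k → ℕ) → Injective _≡_ _≡_ h →
              ∃ λ (π : Permutation′ k) → ∀ {i j} → h i < h j → toℕ (π ⟨$⟩ʳ i) < toℕ (π ⟨$⟩ʳ j)
standardize h h-inj =
  π , λ {i} {j} lt → subst₂ _<_ (cong toℕ (sym (π≗ i))) (cong toℕ (sym (π≗ j))) (rank-mono h lt)
  where
  rank-inj : Injective _≡_ _≡_ (rank h)
  rank-inj {i} {j} eq with <-cmp (h i) (h j)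
  ... | tri< lt _ _ = contradiction (rank-mono h lt) (<-irrefl (cong toℕ eq))
  ... | tri≈ _ e _ = h-inj e
  ... | tri> _ _ gt = contradiction (rank-mono h gt) (<-irrefl (cong toℕ (sym eq)))
  π  = proj₁ (injective⇒permutation (rank h) rank-inj)
  π≗ = proj₂ (injective⇒permutation (rank h) rank-inj)

increasing⇒injective : {f : Fin k → Fin n} → (∀ {i j} → i Fin.< j → f i Fin.< f j) →
                       Injective _≡_ _≡_ f
increasing⇒injective {f = f} inc {i} {j} eq with <-cmp (toℕ i) (toℕ j)
... | tri< i<j _ _ = contradiction (inc i<j) (<-irrefl (cong toℕ eq))
... | tri≈ _ i≡j _ = Fin.toℕ-injective i≡j
... | tri> _ _ j<i = contradiction (inc j<i) (<-irrefl (cong toℕ (sym eq)))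

minimal : {P : Fin k → Set} → Decidable P → (μ : Fin k → ℕ) → ∃ P →
          ∃ λ i → P i × ∀ {j} → P j → μ i ≤ μ j
minimal {P = P} P? μ (i₀ , pi₀) = go (suc (μ i₀)) i₀ pi₀ ≤-refl
  where
  go : ∀ fuel i → P i → μ i < fuel → ∃ λ i → P i × ∀ {j} → P j → μ i ≤ μ j
  go (suc fuel) i pi (s≤s μi≤fuel) with Fin.any? (λ j → P? j ×-dec (μ j <? μ i))
  ... | yes (j , pj , μj<μi) = go fuel j pj (<-≤-trans μj<μi μi≤fuel)
  ... | no ¬smaller = i , pi , λ {j} pj → ≮⇒≥ (λ μj<μi → ¬smaller (j , pj , μj<μi))

∣-∣-split : ∀ {l m n} → l ≤ m → m ≤ n → ∣ l - m ∣ + ∣ m - n ∣ ≡ ∣ l - n ∣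
∣-∣-split {l} {m} {n} l≤m m≤n = begin
  ∣ l - m ∣ + ∣ m - n ∣  ≡⟨ cong₂ _+_ (m≤n⇒∣m-n∣≡n∸m l≤m) (m≤n⇒∣m-n∣≡n∸m m≤n) ⟩
  (m ∸ l) + (n ∸ m)      ≡⟨ +-comm (m ∸ l) (n ∸ m) ⟩
  (n ∸ m) + (m ∸ l)      ≡⟨ +-∸-assoc (n ∸ m) l≤m ⟨
  (n ∸ m) + m ∸ l        ≡⟨ cong (_∸ l) (m∸n+n≡m m≤n) ⟩
  n ∸ l                  ≡⟨ m≤n⇒∣m-n∣≡n∸m (≤-trans l≤m m≤n) ⟨
  ∣ l - n ∣              ∎
  where open ≡-Reasoning

∣-∣-< : ∀ {m n} → m < n → ∣ m - n ∣ ≡ suc (n ∸ suc m)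
∣-∣-< {m} m<n = trans (m≤n⇒∣m-n∣≡n∸m (<⇒≤ m<n)) (+-∸-assoc 1 m<n)

glue : ∀ {l m} → (Fin l → Fin n) → (Fin m → Fin n) → Fin (l + m) → Fin n
glue {l = l} f g = [ f , g ]′ ∘ splitAt l

glue-injective : ∀ {l m} {f : Fin l → Fin n} {g : Fin m → Fin n} →
                 Injective _≡_ _≡_ f → Injective _≡_ _≡_ g → (∀ i j → f i ≢ g j) →
                 Injective _≡_ _≡_ (glue f g)
glue-injective {l = l} {m} {f} {g} f-inj g-inj f≢g {i} {j} eq =
  trans (sym (Fin.join-splitAt l m i)) (trans (cong (join l m) (sides (splitAt l i) (splitAt l j) eq))
    (Fin.join-splitAt l m j))
  where
  sides : ∀ s t → [ f , g ]′ s ≡ [ f , g ]′ t → s ≡ t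
  sides (inj₁ _) (inj₁ _) eq = cong inj₁ (f-inj eq)
  sides (inj₁ _) (inj₂ _) eq = contradiction eq (f≢g _ _)
  sides (inj₂ _) (inj₁ _) eq = contradiction (sym eq) (f≢g _ _)
  sides (inj₂ _) (inj₂ _) eq = cong inj₂ (g-inj eq)

-- Pigeonhole principle: families with disjoint images would glue to an injection into `Fin n`.
common-value : ∀ {l m} {f : Fin l → Fin n} {g : Fin m → Fin n} →
               Injective _≡_ _≡_ f → Injective _≡_ _≡_ g → n < l + m →
               ∃ λ i → ∃ λ j → f i ≡ g j
common-value {f = f} {g} f-inj g-inj n<l+m with Fin.any? (λ i → Fin.any? (λ j → f i Fin.≟ g j))
... | yes hit = hit
... | no miss = contradiction
  (Fin.injective⇒≤ (glue-injective f-inj g-inj (λ i j eq → miss (i , j , eq)))) (<⇒≱ n<l+m)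

-- Points of a permutation and their coordinates

coordinate : Permutation′ n → Fin n → ℕ
coordinate X p = toℕ (X ⟨$⟩ʳ p)

-- Points are indexed by their positions. Position is the coordinate of the identity, value that of
-- `σ`, and composing with `reverse` reflects either, so that all of them are treated alike.
module Coordinate (X : Permutation′ n) where

  x : Fin n → ℕ
  x = coordinate X

  x<n : ∀ p → x p < n
  x<n p = Fin.toℕ<n (X ⟨$⟩ʳ p)

  x-injective : Injective _≡_ _≡_ x
  x-injective {p} {q} eq = trans (sym (inverseˡ X))
    (trans (cong (X ⟨$⟩ˡ_) (Fin.toℕ-injective eq)) (inverseˡ X))

  x-≤∧≢⇒< : ∀ {p q} → x p ≤ x q → p ≢ q → x p < x q
  x-≤∧≢⇒< xp≤xq p≢q = ≤∧≢⇒< xp≤xq (p≢q ∘ x-injective)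

  module _ {p q} (p<q : x p < x q) where

    private
      bound : (t : Fin (x q ∸ suc (x p))) → suc (x p) + toℕ t < x q
      bound t = subst (_< x q) (+-comm (toℕ t) (suc (x p)))
        (m≤o∸n⇒m+n≤o (suc (toℕ t)) p<q (Fin.toℕ<n t))

    between : Fin (x q ∸ suc (x p)) → Fin n
    between t = X ⟨$⟩ˡ fromℕ< (<-trans (bound t) (x<n q))

    x-between : ∀ t → x (between t) ≡ suc (x p) + toℕ t
    x-between t = trans (cong toℕ (inverseʳ X)) (Fin.toℕ-fromℕ< _)

    between> : ∀ t → x p < x (between t)
    between> t = subst (x p <_) (sym (x-between t)) (s≤s (m≤m+n (x p) (toℕ t)))

    between< : ∀ t → x (between t) < x q
    between< t = subst (_< x q) (sym (x-between t)) (bound t)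

    between-injective : Injective _≡_ _≡_ between
    between-injective {s} {t} eq = Fin.toℕ-injective (+-cancelˡ-≡ (suc (x p)) _ _
      (trans (sym (x-between s)) (trans (cong x eq) (x-between t))))

-- The matching of two copies and its chains

module Chains (a b : Fin k → Fin n)
              (a-injective : Injective _≡_ _≡_ a) (b-injective : Injective _≡_ _≡_ b) where

  Initial : Fin n → Set
  Initial p = ∀ i → b i ≢ p

  initial? : Decidable Initial
  initial? p with Fin.any? (λ i → b i Fin.≟ p)
  ... | yes (i , eq) = no λ init → init i eq
  ... | no ∄ = yes λ i eq → ∄ (i , eq)

  data View : Fin n → Set where
    initial : ∀ {p} → Initial p → View p
    image   : ∀ i → View (b i)

  view : ∀ p → View p
  view p with Fin.any? (λ i → b i Fin.≟ p)
  ... | yes (i , refl) = image i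
  ... | no ∄ = initial λ i eq → ∄ (i , eq)

  -- One step back along the matching of `a i` with `b i`; the points missed by `b` start the chains
  -- and are fixed.
  back : Fin n → Fin n
  back p with view p
  ... | initial _ = p
  ... | image i = a i

  back-initial : ∀ {p} → Initial p → back p ≡ p
  back-initial {p} init with view p
  ... | initial _ = refl
  ... | image i = contradiction refl (init i)

  back-b : ∀ i → back (b i) ≡ a i
  back-b i = lemma i refl
    where
    lemma : ∀ {p} j → p ≡ b j → back p ≡ a j
    lemma {p} j eq with view p
    ... | initial init = contradiction (sym eq) (init j)
    ... | image l = cong a (b-injective eq)

  back^ : ℕ → Fin n → Fin n
  back^ zero    p = p
  back^ (suc m) p = back^ m (back p)

  back^-initial : ∀ m {p} → Initial p → back^ m p ≡ p
  back^-initial zero    init = refl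
  back^-initial (suc m) init rewrite back-initial init = back^-initial m init

  back^-suc : ∀ m p → back^ (suc m) p ≡ back (back^ m p)
  back^-suc zero    p = refl
  back^-suc (suc m) p = back^-suc m (back p)

  -- On a forward chain `n` steps reach the start, as every step lowers a coordinate that is less
  -- than `n`.
  source : Fin n → Fin n
  source = back^ n

  source-initial : ∀ {p} → Initial p → source p ≡ p
  source-initial = back^-initial n

  module Along
    (X : Permutation′ n)
    (mono : ∀ {i j} → coordinate X (a i) < coordinate X (a j) → coordinate X (b i) < coordinate X (b j))
    where

    open Coordinate X

    reflect : ∀ {i j} → x (b i) < x (b j) → x (a i) < x (a j)
    reflect = mono⇒reflects-< (x ∘ a) (x ∘ b) (a-injective ∘ x-injective) mono

    Forward : Fin n → Set
    Forward p = ∀ {i} → b i ≡ p → x (a i) < x (b i)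

    -- The direction persists backwards: if `b j ≡ a i`, then `b j` lies before `b i`, so that `a j`
    -- lies before `a i`.
    forward-a : ∀ {i} → x (a i) < x (b i) → Forward (a i)
    forward-a {i} ai<bi {j} bj≡ai =
      subst (x (a j) <_) (cong x (sym bj≡ai)) (reflect (subst (_< x (b i)) (cong x (sym bj≡ai)) ai<bi))

    back^-becomes-initial : ∀ m {p} → Forward p → x p < m → Initial (back^ m p)
    back^-becomes-initial (suc m) {p} fwd (s≤s xp≤m) with view p
    ... | initial init = subst Initial (sym (back^-initial m init)) init
    ... | image i = back^-becomes-initial m (forward-a (fwd refl)) (<-≤-trans (fwd refl) xp≤m)

    source-is-initial : ∀ {p} → Forward p → Initial (source p)
    source-is-initial fwd = back^-becomes-initial n fwd (x<n _)

    -- The source of `b i` is already initial, so one more step back does not change it.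
    source-a : ∀ {i} → Forward (b i) → source (a i) ≡ source (b i)
    source-a {i} fwd = trans (cong source (sym (back-b i)))
      (trans (back^-suc n (b i)) (back-initial (source-is-initial fwd)))

    source-≤ : ∀ {p} → Forward p → x (source p) ≤ x p
    source-≤ {p} fwd = go (suc (x p)) fwd ≤-refl
      where
      go : ∀ m {p} → Forward p → x p < m → x (source p) ≤ x p
      go (suc m) {p} fwd (s≤s xp≤m) with view p
      ... | initial init = ≤-reflexive (cong x (source-initial init))
      ... | image i = begin
        x (source (b i))  ≡⟨ cong x (source-a fwd) ⟨
        x (source (a i))  ≤⟨ go m (forward-a (fwd refl)) (<-≤-trans (fwd refl) xp≤m) ⟩
        x (a i)           ≤⟨ <⇒≤ (fwd refl) ⟩
        x (b i)           ∎
        where open ≤-Reasoning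

    -- Going back along the chain of `p` until `a i` is its own source finds the first step of the
    -- chain.
    source-departs : ∀ {p} → Forward p → source p ≢ p →
                     ∃ λ i → a i ≡ source p × x (a i) < x (b i)
    source-departs {p} fwd s≢p = go (suc (x p)) fwd s≢p ≤-refl
      where
      go : ∀ m {p} → Forward p → source p ≢ p → x p < m →
           ∃ λ i → a i ≡ source p × x (a i) < x (b i)
      go (suc m) {p} fwd s≢p (s≤s xp≤m) with view p
      ... | initial init = contradiction (source-initial init) s≢p
      ... | image i with a i Fin.≟ source (a i)
      ...   | yes eq = i , trans eq (source-a fwd) , fwd refl
      ...   | no neq with j , aj≡ , lt ← go m (forward-a (fwd refl)) (neq ∘ sym) (<-≤-trans (fwd refl) xp≤m) =
                j , trans aj≡ (source-a fwd) , lt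

    -- Two chains that interlace go on interlacing backwards: if `p` is `b j`, then `a i` lies
    -- strictly between `a j` and `b j`. This ends at an initial `p`, which is its own source,
    -- whereas the other source is at most `a i`.
    sources-differ : ∀ {p i} → Forward p → Forward (b i) → x (a i) < x p → x p < x (b i) →
                     source p ≢ source (b i)
    sources-differ {p} {i} = go (suc (x (b i))) ≤-refl
      where
      go : ∀ m {p i} → x (b i) < m → Forward p → Forward (b i) → x (a i) < x p → x p < x (b i) →
           source p ≢ source (b i)
      go (suc m) {p} {i} (s≤s xbi≤m) fwd fwd-b ai<p p<bi eq with view p
      ... | initial init = <-irrefl refl (begin-strict
        x p               ≡⟨ cong x (source-initial init) ⟨
        x (source p)      ≡⟨ cong x eq ⟩
        x (source (b i))  ≡⟨ cong x (source-a fwd-b) ⟨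
        x (source (a i))  ≤⟨ source-≤ (forward-a (fwd-b refl)) ⟩
        x (a i)           <⟨ ai<p ⟩
        x p               ∎)
        where open ≤-Reasoning
      ... | image j = go m (<-≤-trans p<bi xbi≤m) (forward-a (fwd-b refl)) fwd (reflect p<bi) ai<p
                        (trans (source-a fwd-b) (sym eq))

    -- A chain meets each strip at most once: it steps over the strip.
    Strip : Fin k → Fin n → Set
    Strip i p = x (a i) ≤ x p × x p < x (b i)

    strip-forward : ∀ {i p} → Strip i p → Forward p
    strip-forward {i} (ai≤p , p<bi) {j} refl = <-≤-trans (reflect p<bi) ai≤p

    strip-departs : ∀ {i j} → Strip i (a j) → x (a j) < x (b j)
    strip-departs {i} {j} (ai≤aj , aj<bi) with a i Fin.≟ a j
    ... | yes eq = subst (λ l → x (a j) < x (b l)) (a-injective eq) aj<bi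
    ... | no neq = <-trans aj<bi (mono (x-≤∧≢⇒< ai≤aj neq))

    source-strip-apart : ∀ {i p q} → Strip i p → Strip i q → x p < x q → source p ≢ source q
    source-strip-apart {i} {p} {q} p∈ q∈ p<q eq with view q
    ... | initial init = <-irrefl (cong x (trans eq (source-initial init)))
                           (≤-<-trans (source-≤ (strip-forward p∈)) p<q)
    -- Here `a j` lies before the strip, so that `p` is strictly between `a j` and `b j`.
    ... | image j = sources-differ (strip-forward p∈) (strip-forward q∈)
                      (<-≤-trans (reflect (proj₂ q∈)) (proj₁ p∈)) p<q eq

    source-strip-injective : ∀ {i p q} → Strip i p → Strip i q → source p ≡ source q → p ≡ q
    source-strip-injective {p = p} {q} p∈ q∈ eq with <-cmp (x p) (x q)
    ... | tri< p<q _ _ = contradiction eq (source-strip-apart p∈ q∈ p<q)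
    ... | tri≈ _ xp≡xq _ = x-injective xp≡xq
    ... | tri> _ _ q<p = contradiction (sym eq) (source-strip-apart q∈ p∈ q<p)

-- Copies with distant points have no rising step

module Descent
  (a b : Fin k → Fin n)
  (a-injective : Injective _≡_ _≡_ a) (b-injective : Injective _≡_ _≡_ b)
  (X Y : Permutation′ n)
  (x-mono : ∀ {i j} → coordinate X (a i) < coordinate X (a j) → coordinate X (b i) < coordinate X (b j))
  (y-mono : ∀ {i j} → coordinate Y (a i) < coordinate Y (a j) → coordinate Y (b i) < coordinate Y (b j))
  (d : ℕ) (n≤k+d : n ≤ k + d)
  (separated : ∀ {p q} → p ≢ q →
     2 + d ≤ ∣ coordinate X p - coordinate X q ∣ + ∣ coordinate Y p - coordinate Y q ∣)
  where

  open Coordinate X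
  open Coordinate Y using () renaming
    ( x to y ; x-≤∧≢⇒< to y-≤∧≢⇒< ; between to betweenʸ ; between> to betweenʸ>
    ; between< to betweenʸ< ; between-injective to betweenʸ-injective )

  open Chains a b a-injective b-injective
  module H = Along X x-mono
  module V = Along Y y-mono

  -- The starting points of the chains that increase in both coordinates.
  record Rising (i : Fin k) : Set where
    constructor rising
    field
      initialʳ : Initial (a i)
      right    : x (a i) < x (b i)
      up       : y (a i) < y (b i)
  open Rising

  rising? : Decidable Rising
  rising? i with initial? (a i) ×-dec (x (a i) <? x (b i) ×-dec y (a i) <? y (b i))
  ... | yes (init , r , u) = yes (rising init r u)
  ... | no ¬r = no λ r → ¬r (initialʳ r , right r , up r)

  -- As `p` and `q` differ, at least one of them is not the source, and its chain departs forward in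
  -- its coordinate. In the other coordinate the chain departs as well, or the source lies in the
  -- strip itself and `strip-departs` applies.
  common-source-rising : ∀ {i j p q} → H.Strip i p → V.Strip j q → p ≢ q → source p ≡ source q →
                         ∃ λ l → Rising l × a l ≡ source p
  common-source-rising {i} {j} {p} {q} p∈ q∈ p≢q eq
    with source p Fin.≟ p | source q Fin.≟ q
  ... | yes sp≡p | yes sq≡q = contradiction (trans (sym sp≡p) (trans eq sq≡q)) p≢q
  ... | yes sp≡p | no sq≢q with l , al≡ , u ← V.source-departs (V.strip-forward q∈) sq≢q =
    l , rising (subst Initial (sym al≡) (V.source-is-initial (V.strip-forward q∈)))
               (H.strip-departs (subst (H.Strip i) (sym (trans al≡ (trans (sym eq) sp≡p))) p∈)) u ,
    trans al≡ (sym eq)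
  ... | no sp≢p | yes sq≡q with l , al≡ , r ← H.source-departs (H.strip-forward p∈) sp≢p =
    l , rising (subst Initial (sym al≡) (H.source-is-initial (H.strip-forward p∈))) r
               (V.strip-departs (subst (V.Strip j) (sym (trans al≡ (trans eq sq≡q))) q∈)) ,
    al≡
  ... | no sp≢p | no sq≢q
    with l , al≡ , r ← H.source-departs (H.strip-forward p∈) sp≢p
       | m , am≡ , u ← V.source-departs (V.strip-forward q∈) sq≢q
    with refl ← a-injective (trans al≡ (trans eq (sym am≡))) =
    l , rising (subst Initial (sym al≡) (H.source-is-initial (H.strip-forward p∈))) r u , al≡

  record Crossing (p q r t : Fin n) : Set where
    constructor crossing
    field
      {h v}   : Fin n
      p<h     : x p < x h
      h<q     : x h < x q
      r<v     : y r < y v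
      v<t     : y v < y t
      h≢v     : h ≢ v
      sources : source h ≡ source v

  -- The last two points are `p` and `q` sorted by height. Thus one argument covers both ends of a
  -- step, where `q` is higher, and two starting points, where `q` is lower.
  data Ends (p q : Fin n) : Fin n → Fin n → Set where
    ascending  : Ends p q p q
    descending : Ends p q q p

  ends-≤ : ∀ {p q r t} → Ends p q r t → y r < y t → y r ≤ y p
  ends-≤ ascending  _   = ≤-refl
  ends-≤ descending r<t = <⇒≤ r<t

  ends-≢ : ∀ {p q r t s} → Ends p q r t → y r < y s → y s < y t → p ≢ s
  ends-≢ ascending  r<s _   p≡s = <-irrefl (cong y p≡s) r<s
  ends-≢ descending _   s<t p≡s = <-irrefl (cong y (sym p≡s)) s<t

  ends-distance : ∀ {p q r t} → Ends p q r t → ∣ y p - y q ∣ ≡ ∣ y r - y t ∣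
  ends-distance ascending  = refl
  ends-distance {p} {q} descending = ∣-∣-comm (y p) (y q)

  ends-split : ∀ {p q r t s} → Ends p q r t → y r < y s → y s < y t →
               ∣ y p - y s ∣ + ∣ y s - y q ∣ ≡ ∣ y p - y q ∣
  ends-split ascending r<s s<t = ∣-∣-split (<⇒≤ r<s) (<⇒≤ s<t)
  ends-split {p} {q} {s = s} descending r<s s<t = begin
    ∣ y p - y s ∣ + ∣ y s - y q ∣  ≡⟨ cong₂ _+_ (∣-∣-comm (y p) (y s)) (∣-∣-comm (y s) (y q)) ⟩
    ∣ y s - y p ∣ + ∣ y q - y s ∣  ≡⟨ +-comm ∣ y s - y p ∣ ∣ y q - y s ∣ ⟩
    ∣ y q - y s ∣ + ∣ y s - y p ∣  ≡⟨ ∣-∣-split (<⇒≤ r<s) (<⇒≤ s<t) ⟩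
    ∣ y q - y p ∣                  ≡⟨ ∣-∣-comm (y q) (y p) ⟩
    ∣ y p - y q ∣                  ∎
    where open ≡-Reasoning

  -- p and q are the ends of both strips.  As they are far apart, at least d points lie
  -- strictly inside the strips, but only d − 1 chains other than that of p exist, so
  -- that some chain meets both strips.
  module _ {i j : Fin k} {p q r t : Fin n} (p-initial : Initial p)
           (ends : Ends p q r t)
           (ai≤p : x (a i) ≤ x p) (p<q : x p < x q) (q≤bi : x q ≤ x (b i))
           (aj≤r : y (a j) ≤ y r) (r<t : y r < y t) (t≤bj : y t ≤ y (b j))
           (p<bj : y p < y (b j)) where

    private
      hpoint : Fin (x q ∸ suc (x p)) → Fin n
      hpoint = between p<q

      vpoint : Fin (y t ∸ suc (y r)) → Fin n
      vpoint = betweenʸ r<t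

      r≤p : y r ≤ y p
      r≤p = ends-≤ ends r<t

      p∈h : H.Strip i p
      p∈h = ai≤p , <-≤-trans p<q q≤bi

      p∈v : V.Strip j p
      p∈v = ≤-trans aj≤r r≤p , p<bj

      hpoint∈ : ∀ s → H.Strip i (hpoint s)
      hpoint∈ s = ≤-trans ai≤p (<⇒≤ (between> p<q s)) , <-≤-trans (between< p<q s) q≤bi

      vpoint∈ : ∀ s → V.Strip j (vpoint s)
      vpoint∈ s = ≤-trans aj≤r (<⇒≤ (betweenʸ> r<t s)) , <-≤-trans (betweenʸ< r<t s) t≤bj

      p≢vpoint : ∀ s → p ≢ vpoint s
      p≢vpoint s = ends-≢ ends (betweenʸ> r<t s) (betweenʸ< r<t s)

      b∪p : Fin (k + 1) → Fin n
      b∪p = glue b (λ (_ : Fin 1) → p)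

      b∪p-injective : Injective _≡_ _≡_ b∪p
      b∪p-injective = glue-injective b-injective (λ { {zero} {zero} _ → refl }) (λ i _ → p-initial i)

      avoids : ∀ {z} → Initial z → p ≢ z → ∀ s → b∪p s ≢ z
      avoids init p≢z s with splitAt k s
      ... | inj₁ l = init l
      ... | inj₂ _ = p≢z

      hsource-injective : Injective _≡_ _≡_ (source ∘ hpoint)
      hsource-injective eq = between-injective p<q (H.source-strip-injective (hpoint∈ _) (hpoint∈ _) eq)

      vsource-injective : Injective _≡_ _≡_ (source ∘ vpoint)
      vsource-injective eq = betweenʸ-injective r<t (V.source-strip-injective (vpoint∈ _) (vpoint∈ _) eq)

      b∪p≢hsource : ∀ s s′ → b∪p s ≢ source (hpoint s′)
      b∪p≢hsource s s′ = avoids (H.source-is-initial (H.strip-forward (hpoint∈ s′)))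
        (λ eq → <-irrefl (cong x (H.source-strip-injective p∈h (hpoint∈ s′)
                                   (trans (source-initial p-initial) eq)))
                         (between> p<q s′)) s

      b∪p≢vsource : ∀ s s′ → b∪p s ≢ source (vpoint s′)
      b∪p≢vsource s s′ = avoids (V.source-is-initial (V.strip-forward (vpoint∈ s′)))
        (λ eq → p≢vpoint s′ (V.source-strip-injective p∈v (vpoint∈ s′)
                               (trans (source-initial p-initial) eq))) s

      b∪p∪h-injective : Injective _≡_ _≡_ (glue b∪p (source ∘ hpoint))
      b∪p∪h-injective = glue-injective b∪p-injective hsource-injective b∪p≢hsource

      -- Of the at most `d` points missed by `b`, one is `p`, which leaves `d − 1` for the sources.
      bound : ∀ {m} → k + 1 + m ≤ n → suc m ≤ d
      bound {m} le = +-cancelˡ-≤ k _ _ (≤-trans (≤-reflexive (sym (+-assoc k 1 m))) (≤-trans le n≤k+d))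

      hbound : suc (x q ∸ suc (x p)) ≤ d
      hbound = bound (Fin.injective⇒≤ b∪p∪h-injective)

      vbound : suc (y t ∸ suc (y r)) ≤ d
      vbound = bound (Fin.injective⇒≤ (glue-injective b∪p-injective vsource-injective b∪p≢vsource))

      p≢q : p ≢ q
      p≢q eq = <-irrefl (cong x eq) p<q

      pq-vertical : ∣ y p - y q ∣ ≡ suc (y t ∸ suc (y r))
      pq-vertical = trans (ends-distance ends) (∣-∣-< r<t)

      pq-far : 2 + d ≤ suc (x q ∸ suc (x p)) + suc (y t ∸ suc (y r))
      pq-far = subst₂ (λ u w → 2 + d ≤ u + w) (∣-∣-< p<q) pq-vertical (separated p≢q)

      enough : n < k + 1 + (x q ∸ suc (x p)) + (y t ∸ suc (y r))
      enough = ≤-from 0 (+-mono-≤ n≤k+d pq-far)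
        (lemma n k d (x q ∸ suc (x p)) (y t ∸ suc (y r)))
        where
        lemma : ∀ n k d u w → suc n + ((k + d) + (suc u + suc w)) + 0 ≡ k + 1 + u + w + (n + (2 + d))
        lemma = solve-∀

      -- Each side of the rectangle is at most d, so that it is too small for a third
      -- point at distance 2 + d from both p and q.
      empty-rectangle : ∀ {s} → x p < x s → x s < x q → y r < y s → y s < y t → ⊥
      empty-rectangle {s} p<s s<q r<s s<t = <-irrefl refl (begin-strict
        d + d
          <⟨ +-mono-< (m<n+m d {2} z<s) (m<n+m d {2} z<s) ⟩
        (2 + d) + (2 + d)
          ≤⟨ +-mono-≤ (separated (λ eq → <-irrefl (cong x eq) p<s))
                      (separated (λ eq → <-irrefl (cong x eq) s<q)) ⟩
        (∣ x p - x s ∣ + ∣ y p - y s ∣) + (∣ x s - x q ∣ + ∣ y s - y q ∣)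
          ≡⟨ interchange ∣ x p - x s ∣ ∣ y p - y s ∣ ∣ x s - x q ∣ ∣ y s - y q ∣ ⟩
        (∣ x p - x s ∣ + ∣ x s - x q ∣) + (∣ y p - y s ∣ + ∣ y s - y q ∣)
          ≡⟨ cong₂ _+_ (∣-∣-split (<⇒≤ p<s) (<⇒≤ s<q)) (ends-split ends r<s s<t) ⟩
        ∣ x p - x q ∣ + ∣ y p - y q ∣
          ≡⟨ cong₂ _+_ (∣-∣-< p<q) pq-vertical ⟩
        suc (x q ∸ suc (x p)) + suc (y t ∸ suc (y r))
          ≤⟨ +-mono-≤ hbound vbound ⟩
        d + d  ∎)
        where
        open ≤-Reasoning
        interchange : ∀ u v w z → (u + v) + (w + z) ≡ (u + w) + (v + z)
        interchange = solve-∀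

    crossing-exists : Crossing p q r t
    crossing-exists
      with s , s′ , eq ← common-value b∪p∪h-injective vsource-injective enough
      with splitAt (k + 1) s
    ... | inj₁ l = contradiction eq (b∪p≢vsource l s′)
    ... | inj₂ l = crossing (between> p<q l) (between< p<q l) (betweenʸ> r<t s′) (betweenʸ< r<t s′)
      (λ h≡v → empty-rectangle (between> p<q l) (between< p<q l)
        (subst (λ z → y r < y z) (sym h≡v) (betweenʸ> r<t s′))
        (subst (λ z → y z < y t) (sym h≡v) (betweenʸ< r<t s′))) eq

  -- Starting from the leftmost rising step, pass to the leftmost rising step that begins
  -- below the current one within its strip, for as long as it also ends below it.  When
  -- this stops, the two ends of the current step or the two starting points are too close.
  Dominated : Fin k → Set
  Dominated i = ∀ {j} → Rising j → x (a j) < x (a i) → y (b i) < y (a j)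

  Next : Fin k → Fin k → Set
  Next i j = Rising j × x (a i) < x (a j) × x (a j) < x (b i) × y (a j) < y (a i)

  next? : ∀ i → Decidable (Next i)
  next? i j = rising? j ×-dec x (a i) <? x (a j) ×-dec x (a j) <? x (b i) ×-dec y (a j) <? y (a i)

  x-source-< : ∀ {p q r} → r ≡ source p → H.Forward p → x p < x q → x r < x q
  x-source-< refl fwd = ≤-<-trans (H.source-≤ fwd)

  y-source-< : ∀ {p q r} → r ≡ source p → V.Forward p → y p < y q → y r < y q
  y-source-< refl fwd = ≤-<-trans (V.source-≤ fwd)

  -- The start `a l` of the crossing chain has no place. To the left of `a i` it is too low for
  -- `Dominated`; at `a i` the chain meets the strip twice; to the right and below `a i` it is a
  -- next step; otherwise it lies in both strips and equals both `h` and `v`.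
  last-impossible : ∀ {i} → Rising i → Dominated i → (∀ j → ¬ Next i j) → ⊥
  last-impossible {i} rise dom ∄next =
    absurd (crossing-exists {i} {i} (initialʳ rise) ascending
             ≤-refl (right rise) ≤-refl ≤-refl (up rise) ≤-refl (up rise))
    where
    absurd : Crossing (a i) (b i) (a i) (b i) → ⊥
    absurd (crossing {h} {v} p<h h<q r<v v<t h≢v sources) = case-on (common-source-rising h∈ v∈ h≢v sources)
      where
      h∈ : H.Strip i h
      h∈ = <⇒≤ p<h , h<q
      v∈ : V.Strip i v
      v∈ = <⇒≤ r<v , v<t
      case-on : (∃ λ l → Rising l × a l ≡ source h) → ⊥
      case-on (l , l-rise , al≡) with <-cmp (x (a l)) (x (a i)) | y (a l) <? y (a i)
      ... | tri< l<i _ _ | _ = <-asym (dom l-rise l<i) (y-source-< (trans al≡ sources) (V.strip-forward v∈) v<t)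
      ... | tri≈ _ eq _  | _ = <-irrefl (cong x (H.source-strip-injective (≤-refl , right rise) h∈
                                 (trans (source-initial (initialʳ rise))
                                   (trans (sym (x-injective eq)) al≡)))) p<h
      ... | tri> _ _ i<l | yes l↓i = ∄next l (l-rise , i<l , (x-source-< al≡ (H.strip-forward h∈) h<q) , l↓i)
      ... | tri> _ _ i<l | no ¬l↓i = h≢v (trans (sym al≡h) al≡v)
        where
        al≡h : a l ≡ h
        al≡h = H.source-strip-injective {i} (<⇒≤ i<l , (x-source-< al≡ (H.strip-forward h∈) h<q)) h∈
                 (trans (source-initial (initialʳ l-rise)) al≡)
        al≡v : a l ≡ v
        al≡v = V.source-strip-injective {i}
                 (≮⇒≥ ¬l↓i , (y-source-< (trans al≡ sources) (V.strip-forward v∈) v<t)) v∈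
                 (trans (source-initial (initialʳ l-rise)) (trans al≡ sources))

  -- The crossing chain between the two starting points begins to the left of `a j` and below `a i`.
  -- This contradicts `Dominated` when it is to the left of `a i`, and the choice of `j` when it is
  -- to the right.
  overlap-impossible : ∀ {i j} → Rising i → Dominated i → Next i j →
                       (∀ {l} → Next i l → x (a j) ≤ x (a l)) → y (a i) ≤ y (b j) → ⊥
  overlap-impossible {i} {j} rise dom (j-rise , i<j , j<bi , j↓i) leftmost i≤bj =
    absurd (crossing-exists {i} {j} (initialʳ rise) descending
             ≤-refl i<j (<⇒≤ j<bi) ≤-refl j↓i i≤bj ai<bj)
    where
    ai<bj : y (a i) < y (b j)
    ai<bj = y-≤∧≢⇒< i≤bj (initialʳ rise j ∘ sym)
    absurd : Crossing (a i) (a j) (a j) (a i) → ⊥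
    absurd (crossing {h} {v} p<h h<q r<v v<t h≢v sources) = case-on (common-source-rising h∈ v∈ h≢v sources)
      where
      h∈ : H.Strip i h
      h∈ = <⇒≤ p<h , <-trans h<q j<bi
      v∈ : V.Strip j v
      v∈ = <⇒≤ r<v , <-trans v<t ai<bj
      case-on : (∃ λ l → Rising l × a l ≡ source h) → ⊥
      case-on (l , l-rise , al≡) = go
        where
        l<j : x (a l) < x (a j)
        l<j = x-source-< al≡ (H.strip-forward h∈) h<q
        l↓i : y (a l) < y (a i)
        l↓i = y-source-< (trans al≡ sources) (V.strip-forward v∈) v<t
        go : ⊥
        go with <-cmp (x (a l)) (x (a i))
        ... | tri< l<i _ _ = <-asym l↓i (<-trans (up rise) (dom l-rise l<i))
        ... | tri≈ _ eq _ = <-irrefl (cong y (x-injective eq)) l↓i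
        ... | tri> _ _ i<l = <⇒≱ l<j (leftmost (l-rise , i<l , <-trans l<j j<bi , l↓i))

  descend : ∀ fuel {i} → n ≤ x (a i) + fuel → Rising i → Dominated i → ⊥
  descend zero {i} le _ _ = <⇒≱ (x<n (a i)) (subst (n ≤_) (+-identityʳ _) le)
  descend (suc fuel) {i} le rise dom with Fin.any? (next? i)
  ... | no ∄next = last-impossible rise dom (λ j nxt → ∄next (j , nxt))
  ... | yes ∃next
    with j , nxt@(j-rise , i<j , j<bi , j↓i) , leftmost ← minimal (next? i) (x ∘ a) ∃next
    with y (a i) ≤? y (b j)
  ...   | yes i≤bj = overlap-impossible rise dom nxt leftmost i≤bj
  ...   | no i≰bj = descend fuel le′ j-rise j-dom
    where
    le′ : n ≤ x (a j) + fuel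
    le′ = ≤-trans (≤-trans le (≤-reflexive (+-suc _ fuel))) (+-monoˡ-≤ fuel i<j)
    bj↓i : y (b j) < y (a i)
    bj↓i = ≰⇒> i≰bj
    -- The step `j` ends below `a i`, and no rising step to the left of `a j` starts lower than
    -- `a i`: further left than `a i` because `i` is dominated, in between because `j` is leftmost.
    j-dom : Dominated j
    j-dom {l} l-rise l<j with <-cmp (x (a l)) (x (a i))
    ... | tri< l<i _ _ = <-trans bj↓i (<-trans (up rise) (dom l-rise l<i))
    ... | tri≈ _ eq _ = subst (λ z → y (b j) < y z) (sym (x-injective eq)) bj↓i
    ... | tri> _ _ i<l = <-≤-trans bj↓i (≮⇒≥ λ l↓i → <⇒≱ l<j (leftmost (l-rise , i<l , <-trans l<j j<bi , l↓i)))

  -- The leftmost step that goes right and up starts at an initial point, since a step arriving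
  -- there would also go right and up and start further left. For this step `Dominated` holds
  -- vacuously.
  no-rise : ∀ i → x (a i) < x (b i) → y (a i) < y (b i) → ⊥
  no-rise i₀ r₀ u₀
    with i , (r , u) , leftmost
           ← minimal (λ i → x (a i) <? x (b i) ×-dec y (a i) <? y (b i)) (x ∘ a) (i₀ , r₀ , u₀) =
    descend n (m≤n+m n _) (rising init r u)
      (λ l-rise l<i → contradiction (leftmost (right l-rise , up l-rise)) (<⇒≱ l<i))
    where
    init : Initial (a i)
    init j bj≡ai = <⇒≱ (H.forward-a r bj≡ai) (subst (λ z → x z ≤ x (a j)) (sym bj≡ai)
      (leftmost (H.forward-a r bj≡ai , V.forward-a u bj≡ai)))

-- Distant points make a separator

sign-≥ : ∀ {m n} → n ≤ m → sign (+ m ℤ.- + n) ≡ Sign.+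
sign-≥ {m} {n} n≤m = cong sign (trans (ℤ.[+m]-[+n]≡m⊖n m n) (ℤ.⊖-≥ n≤m))

sign-< : ∀ {m n} → m < n → sign (+ m ℤ.- + n) ≡ Sign.-
sign-< {m} {n} m<n = trans (cong sign (ℤ.[+m]-[+n]≡m⊖n m n)) (ℤ.sign-⊖-< m<n)

same-sign-< : ∀ {m n m′ n′} → sign (+ m ℤ.- + n) ≡ sign (+ m′ ℤ.- + n′) → m < n → m′ < n′
same-sign-< {m} {n} {m′} {n′} eq m<n with m′ <? n′
... | yes m′<n′ = m′<n′
... | no m′≮n′ = case trans (sym (sign-< m<n)) (trans eq (sign-≥ (≮⇒≥ m′≮n′))) of λ ()

same-sign-≥ : ∀ {m n m′ n′} → sign (+ m ℤ.- + n) ≡ sign (+ m′ ℤ.- + n′) → n ≤ m → n′ ≤ m′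
same-sign-≥ eq n≤m = ≮⇒≥ λ m′<n′ → <⇒≱ (same-sign-< (sym eq) m′<n′) n≤m

opposite-< : {i j : Fin n} → toℕ i < toℕ j → toℕ (opposite j) < toℕ (opposite i)
opposite-< {n} {i} {j} i<j = subst₂ _<_ (sym (Fin.opposite-prop j)) (sym (Fin.opposite-prop i))
  (∸-monoʳ-< (s≤s i<j) (Fin.toℕ<n j))

opposite-<⁻ : {i j : Fin n} → toℕ (opposite i) < toℕ (opposite j) → toℕ j < toℕ i
opposite-<⁻ {i = i} {j} lt =
  subst₂ (λ p q → toℕ p < toℕ q) (Fin.opposite-involutive j) (Fin.opposite-involutive i) (opposite-< lt)

-- Adding `suc i + suc j` to both complements turns them into `n + suc j` and `n + suc i`, which
-- avoids truncated subtraction.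
opposite-distance : (i j : Fin n) → ∣ toℕ (opposite i) - toℕ (opposite j) ∣ ≡ ∣ toℕ i - toℕ j ∣
opposite-distance {n} i j = begin
  ∣ i′ - j′ ∣
    ≡⟨ ∣m+n-m+o∣≡∣n-o∣ (suc (toℕ i) + suc (toℕ j)) i′ j′ ⟨
  ∣ suc (toℕ i) + suc (toℕ j) + i′ - suc (toℕ i) + suc (toℕ j) + j′ ∣
    ≡⟨ cong₂ ∣_-_∣ (trans (swap₁ (suc (toℕ i)) (suc (toℕ j)) i′) (cong (_+ suc (toℕ j)) (complement i)))
                   (trans (swap₂ (suc (toℕ i)) (suc (toℕ j)) j′) (cong (_+ suc (toℕ i)) (complement j))) ⟩
  ∣ n + suc (toℕ j) - n + suc (toℕ i) ∣
    ≡⟨ ∣m+n-m+o∣≡∣n-o∣ n (suc (toℕ j)) (suc (toℕ i)) ⟩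
  ∣ toℕ j - toℕ i ∣
    ≡⟨ ∣-∣-comm (toℕ j) (toℕ i) ⟩
  ∣ toℕ i - toℕ j ∣ ∎
  where
  open ≡-Reasoning
  i′ = toℕ (opposite i)
  j′ = toℕ (opposite j)
  swap₁ : ∀ u v w → u + v + w ≡ w + u + v
  swap₁ = solve-∀
  swap₂ : ∀ u v w → u + v + w ≡ w + v + u
  swap₂ = solve-∀
  complement : ∀ l → toℕ (opposite l) + suc (toℕ l) ≡ n
  complement l = trans (cong (_+ suc (toℕ l)) (Fin.opposite-prop l)) (m∸n+n≡m (Fin.toℕ<n l))

Spread : ℕ → (Fin n → Fin n) → Set
Spread s f = ∀ {p q} → p ≢ q → s ≤ ∣ toℕ p - toℕ q ∣ + ∣ toℕ (f p) - toℕ (f q) ∣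

module _ {σ : Permutation′ n} {π : Permutation′ k} {a b : Fin k → Fin n}
         (a-copy : IsCopy π σ a) (b-copy : IsCopy π σ b)
         (n≤k+d : n ≤ k + d) (spread : Spread (2 + d) (σ ⟨$⟩ʳ_)) where

  private
    module A = IsCopy a-copy
    module B = IsCopy b-copy

    value : Fin n → ℕ
    value p = toℕ (σ ⟨$⟩ʳ p)

    a-injective : Injective _≡_ _≡_ a
    a-injective = increasing⇒injective A.increasing

    b-injective : Injective _≡_ _≡_ b
    b-injective = increasing⇒injective B.increasing

    position-mono : ∀ {i j} → toℕ (a i) < toℕ (a j) → toℕ (b i) < toℕ (b j)
    position-mono lt = B.increasing (mono⇒reflects-< toℕ (toℕ ∘ a) Fin.toℕ-injective A.increasing lt)

    signs : ∀ {i j} → toℕ i < toℕ j →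
            sign (+ value (a j) ℤ.- + value (a i)) ≡ sign (+ value (b j) ℤ.- + value (b i))
    signs i<j = trans (A.sameSigns _ _ i<j) (sym (B.sameSigns _ _ i<j))

    value-mono : ∀ {i j} → value (a i) < value (a j) → value (b i) < value (b j)
    value-mono {i} {j} lt with <-cmp (toℕ i) (toℕ j)
    -- A positive sign only gives `≤`, as zero counts as positive; equality is excluded by
    -- injectivity.
    ... | tri< i<j _ _ = Coordinate.x-≤∧≢⇒< σ (same-sign-≥ (signs i<j) (<⇒≤ lt))
                           (λ eq → <-irrefl (cong toℕ (b-injective eq)) i<j)
    ... | tri≈ _ i≡j _ = contradiction lt (<-irrefl (cong (value ∘ a) (Fin.toℕ-injective i≡j)))
    ... | tri> _ _ j<i = same-sign-< (signs j<i) lt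

    Far : ∀ (X Y : Permutation′ n) → Set
    Far X Y = ∀ {p q} → p ≢ q →
      2 + d ≤ ∣ toℕ (X ⟨$⟩ʳ p) - toℕ (X ⟨$⟩ʳ q) ∣ + ∣ toℕ (Y ⟨$⟩ʳ p) - toℕ (Y ⟨$⟩ʳ q) ∣

    flip-right : ∀ X Y → Far X Y → Far X (Y ∘ₚ reverse)
    flip-right X Y far {p} {q} p≢q = subst (λ l → 2 + d ≤ ∣ toℕ (X ⟨$⟩ʳ p) - toℕ (X ⟨$⟩ʳ q) ∣ + l)
      (sym (opposite-distance (Y ⟨$⟩ʳ p) (Y ⟨$⟩ʳ q))) (far p≢q)

    flip-left : ∀ X Y → Far X Y → Far (X ∘ₚ reverse) Y
    flip-left X Y far {p} {q} p≢q = subst (λ l → 2 + d ≤ l + ∣ toℕ (Y ⟨$⟩ʳ p) - toℕ (Y ⟨$⟩ʳ q) ∣)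
      (sym (opposite-distance (X ⟨$⟩ʳ p) (X ⟨$⟩ʳ q))) (far p≢q)

    P P⁻ σ⁻ : Permutation′ n
    P  = Permutation.id
    P⁻ = Permutation.id ∘ₚ reverse
    σ⁻ = σ ∘ₚ reverse

    position-mono⁻ : ∀ {i j} → toℕ (opposite (a i)) < toℕ (opposite (a j)) →
                     toℕ (opposite (b i)) < toℕ (opposite (b j))
    position-mono⁻ = opposite-< ∘ position-mono ∘ opposite-<⁻

    value-mono⁻ : ∀ {i j} → toℕ (opposite (σ ⟨$⟩ʳ a i)) < toℕ (opposite (σ ⟨$⟩ʳ a j)) →
                  toℕ (opposite (σ ⟨$⟩ʳ b i)) < toℕ (opposite (σ ⟨$⟩ʳ b j))
    value-mono⁻ = opposite-< ∘ value-mono ∘ opposite-<⁻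

    open Descent a b a-injective b-injective using (no-rise)

  -- Reversing positions or values, we may assume that a i moves right and up.
  copies-agree : ∀ i → a i ≡ b i
  copies-agree i with a i Fin.≟ b i
  ... | yes eq = eq
  ... | no neq with <-cmp (toℕ (a i)) (toℕ (b i)) | <-cmp (value (a i)) (value (b i))
  ... | tri≈ _ eq _ | _ = Fin.toℕ-injective eq
  ... | _ | tri≈ _ eq _ = Coordinate.x-injective σ eq
  ... | tri< r _ _ | tri< u _ _ =
    ⊥-elim (no-rise P σ position-mono value-mono d n≤k+d spread i r u)
  ... | tri< r _ _ | tri> _ _ u =
    ⊥-elim (no-rise P σ⁻ position-mono value-mono⁻ d n≤k+d (flip-right P σ spread)
             i r (opposite-< u))
  ... | tri> _ _ r | tri< u _ _ =
    ⊥-elim (no-rise P⁻ σ position-mono⁻ value-mono d n≤k+d (flip-left P σ spread)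
             i (opposite-< r) u)
  ... | tri> _ _ r | tri> _ _ u =
    ⊥-elim (no-rise P⁻ σ⁻ position-mono⁻ value-mono⁻ d n≤k+d
             (flip-right P⁻ σ (flip-left P σ spread)) i (opposite-< r) (opposite-< u))

spread⇒separator : (σ : Permutation′ n) → k ≤ n → n ≤ k + d → Spread (2 + d) (σ ⟨$⟩ʳ_) → IsSeparator k σ
spread⇒separator σ k≤n n≤k+d spread =
  k≤n , λ π a b a-copy b-copy → copies-agree a-copy b-copy n≤k+d spread

-- Permutations with distant points

≤⇒≤∣-∣ : ∀ {l e m} → l + e ≤ m → e ≤ ∣ l - m ∣
≤⇒≤∣-∣ {l} {e} {m} le = begin
  e          ≤⟨ m+n≤o⇒m≤o∸n e (≤-trans (≤-reflexive (+-comm e l)) le) ⟩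
  m ∸ l      ≡⟨ m≤n⇒∣m-n∣≡n∸m (m+n≤o⇒m≤o l le) ⟨
  ∣ l - m ∣  ∎
  where open ≤-Reasoning

module Residue (a N : ℕ) .{{_ : NonZero N}} where

  residue : ℕ → ℕ
  residue i = a * i % N

  FarApart : ℕ → Set
  FarApart s = ∀ i δ e → 0 < δ →
    residue (i + δ) ≡ residue i + e ⊎ residue i ≡ residue (i + δ) + e → s ≤ δ + e

  private
    split : ∀ i → a * i ≡ residue i + (a * i / N) * N
    split i = m≡m%n+[m/n]*n (a * i) N

  -- The congruence `a * δ ≡ e` modulo `N`; multiples of `N` on both sides replace subtraction. In
  -- `step-down` it is `a * δ ≡ − e`.
  step-up : ∀ i δ e → residue (i + δ) ≡ residue i + e →
            ∃ λ q → ∃ λ q′ → a * δ + q * N ≡ e + q′ * N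
  step-up i δ e eq = q , q′ , +-cancelˡ-≡ (residue i) _ _ (begin
    residue i + (a * δ + q * N)   ≡⟨ shuffle (residue i) (a * δ) (q * N) ⟩
    (residue i + q * N) + a * δ   ≡⟨ cong (_+ a * δ) (split i) ⟨
    a * i + a * δ                 ≡⟨ *-distribˡ-+ a i δ ⟨
    a * (i + δ)                   ≡⟨ split (i + δ) ⟩
    residue (i + δ) + q′ * N      ≡⟨ cong (_+ q′ * N) eq ⟩
    residue i + e + q′ * N        ≡⟨ +-assoc (residue i) e (q′ * N) ⟩
    residue i + (e + q′ * N)      ∎)
    where
    open ≡-Reasoning
    q  = a * i / N
    q′ = a * (i + δ) / N
    shuffle : ∀ u v w → u + (v + w) ≡ (u + w) + v
    shuffle = solve-∀

  step-down : ∀ i δ e → residue i ≡ residue (i + δ) + e →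
              ∃ λ q → ∃ λ q′ → a * δ + e + q * N ≡ q′ * N
  step-down i δ e eq = q , q′ , +-cancelˡ-≡ (residue (i + δ)) _ _ (begin
    residue (i + δ) + (a * δ + e + q * N)  ≡⟨ shuffle (residue (i + δ)) (a * δ) e (q * N) ⟩
    (residue (i + δ) + e) + q * N + a * δ  ≡⟨ cong (λ u → u + q * N + a * δ) eq ⟨
    residue i + q * N + a * δ              ≡⟨ cong (_+ a * δ) (split i) ⟨
    a * i + a * δ                          ≡⟨ *-distribˡ-+ a i δ ⟨
    a * (i + δ)                            ≡⟨ split (i + δ) ⟩
    residue (i + δ) + q′ * N               ∎)
    where
    open ≡-Reasoning
    q  = a * i / N
    q′ = a * (i + δ) / N
    shuffle : ∀ u v w z → u + (v + w + z) ≡ (u + w) + z + v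
    shuffle = solve-∀

  Onto : Set
  Onto = ∀ w → w < N → ∃ λ j → j < N × residue j ≡ w

  module _ {s n : ℕ} (far : FarApart s) (onto : Onto) (N≤n : N ≤ n) where

    private
      -- Residues repeat when `n` exceeds `N`; the position breaks ties.
      key : Fin n → ℕ
      key i = residue (toℕ i) * n + toℕ i

      key-mono : ∀ {i j} → residue (toℕ i) < residue (toℕ j) → key i < key j
      key-mono {i} {j} lt = begin-strict
        residue (toℕ i) * n + toℕ i  <⟨ +-monoʳ-< (residue (toℕ i) * n) (Fin.toℕ<n i) ⟩
        residue (toℕ i) * n + n      ≡⟨ +-comm (residue (toℕ i) * n) n ⟩
        suc (residue (toℕ i)) * n    ≤⟨ *-monoˡ-≤ n lt ⟩
        residue (toℕ j) * n          ≤⟨ m≤m+n _ (toℕ j) ⟩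
        key j                        ∎
        where open ≤-Reasoning

      key-injective : Injective _≡_ _≡_ key
      key-injective {i} {j} eq with <-cmp (residue (toℕ i)) (residue (toℕ j))
      ... | tri< lt _ _ = contradiction (key-mono lt) (<-irrefl eq)
      ... | tri≈ _ r≡ _ = Fin.toℕ-injective (+-cancelˡ-≡ (residue (toℕ j) * n) _ _
                            (trans (cong (λ r → r * n + toℕ i) (sym r≡)) eq))
      ... | tri> _ _ gt = contradiction (key-mono gt) (<-irrefl (sym eq))

      σ : Permutation′ n
      σ = proj₁ (standardize key key-injective)

      value : Fin n → ℕ
      value p = toℕ (σ ⟨$⟩ʳ p)

      value-mono : ∀ {i j} → residue (toℕ i) < residue (toℕ j) → value i < value j
      value-mono lt = proj₂ (standardize key key-injective) (key-mono lt)

      -- All residues between those of i and j occur among positions below N.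
      value-gap : ∀ m {i j} → residue (toℕ j) ≡ residue (toℕ i) + suc m → value i + suc m ≤ value j
      value-gap zero {i} {j} eq = subst (_≤ value j) (+-comm 1 (value i))
        (value-mono (subst (residue (toℕ i) <_) (sym eq) (m<m+n _ z<s)))
      value-gap (suc m) {i} {j} eq
        with l , l<N , l≡ ← onto (residue (toℕ i) + suc m)
               (<-trans (subst (residue (toℕ i) + suc m <_) (sym eq) (+-monoʳ-< _ ≤-refl)) (m%n<n (a * toℕ j) N)) =
        begin
          value i + suc (suc m)  ≡⟨ +-suc (value i) (suc m) ⟩
          suc (value i + suc m)  ≤⟨ s≤s (value-gap m (trans (cong residue l′≡l) l≡)) ⟩
          suc (value l′)         ≤⟨ value-mono (subst₂ _<_ (sym (trans (cong residue l′≡l) l≡)) (sym eq)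
                                                 (+-monoʳ-< _ ≤-refl)) ⟩
          value j                ∎
        where
        open ≤-Reasoning
        l′ : Fin n
        l′ = fromℕ< (<-≤-trans l<N N≤n)
        l′≡l : toℕ l′ ≡ l
        l′≡l = Fin.toℕ-fromℕ< _

      value-distance : ∀ e {i j} → residue (toℕ j) ≡ residue (toℕ i) + e → e ≤ ∣ value i - value j ∣
      value-distance zero    eq = z≤n
      value-distance (suc m) eq = ≤⇒≤∣-∣ (value-gap m eq)

      spread-< : ∀ {p q} → toℕ p < toℕ q → s ≤ ∣ toℕ p - toℕ q ∣ + ∣ value p - value q ∣
      spread-< {p} {q} p<q with ≤-total (residue (toℕ p)) (residue (toℕ q))
      ... | inj₁ le = ≤-trans
        (far (toℕ p) (toℕ q ∸ toℕ p) (residue (toℕ q) ∸ residue (toℕ p)) (m<n⇒0<n∸m p<q)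
          (inj₁ (trans (cong residue q≡) (sym (m+[n∸m]≡n le)))))
        (+-mono-≤ (≤-reflexive (sym (m≤n⇒∣m-n∣≡n∸m (<⇒≤ p<q))))
          (value-distance _ (sym (m+[n∸m]≡n le))))
        where
        q≡ : toℕ p + (toℕ q ∸ toℕ p) ≡ toℕ q
        q≡ = m+[n∸m]≡n (<⇒≤ p<q)
      ... | inj₂ ge = ≤-trans
        (far (toℕ p) (toℕ q ∸ toℕ p) (residue (toℕ p) ∸ residue (toℕ q)) (m<n⇒0<n∸m p<q)
          (inj₂ (trans (sym (m+[n∸m]≡n ge))
            (cong (λ r → residue r + (residue (toℕ p) ∸ residue (toℕ q))) (sym q≡)))))
        (+-mono-≤ (≤-reflexive (sym (m≤n⇒∣m-n∣≡n∸m (<⇒≤ p<q))))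
          (≤-trans (value-distance _ (sym (m+[n∸m]≡n ge))) (≤-reflexive (∣-∣-comm (value q) (value p)))))
        where
        q≡ : toℕ p + (toℕ q ∸ toℕ p) ≡ toℕ q
        q≡ = m+[n∸m]≡n (<⇒≤ p<q)

    residue-permutation : ∃ λ (σ : Permutation′ n) → Spread s (σ ⟨$⟩ʳ_)
    residue-permutation = σ , spread
      where
      spread : Spread s (σ ⟨$⟩ʳ_)
      spread {p} {q} p≢q with <-cmp (toℕ p) (toℕ q)
      ... | tri< p<q _ _ = spread-< p<q
      ... | tri≈ _ eq _ = contradiction (Fin.toℕ-injective eq) p≢q
      ... | tri> _ _ q<p = subst₂ (λ u v → s ≤ u + v) (∣-∣-comm (toℕ q) (toℕ p))
                             (∣-∣-comm (value q) (value p)) (spread-< q<p)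

-- The inverse of a modulo M + 2 is − c.
onto-from : ∀ a c M → a * c ≡ 2 * M + 3 → Residue.Onto a (2 + M)
onto-from a c M ac≡ w w<N = j % N , m%n<n j N , (begin
  a * (j % N) % N              ≡⟨ %-distribˡ-* a (j % N) N ⟩
  (a % N) * (j % N % N) % N    ≡⟨ cong (λ r → (a % N) * r % N) (m%n%n≡m%n j N) ⟩
  (a % N) * (j % N) % N        ≡⟨ %-distribˡ-* a j N ⟨
  a * j % N                    ≡⟨ cong (_% N) multiple ⟩
  (w + (2 * M + 1) * w * N) % N  ≡⟨ [m+kn]%n≡m%n w ((2 * M + 1) * w) N ⟩
  w % N                        ≡⟨ m<n⇒m%n≡m w<N ⟩
  w                            ∎)
  where
  open ≡-Reasoning
  N = 2 + M
  -- The factor `1 + M` is `N − 1` and acts as `− 1` modulo `N`, so that `j` represents `− c * w`.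
  j = c * w * (1 + M)
  multiple : a * j ≡ w + (2 * M + 1) * w * N
  multiple = trans (reassociate a c w M) (trans (cong (λ r → r * (w * (1 + M))) ac≡) (expand w M))
    where
    reassociate : ∀ a c w M → a * (c * w * (1 + M)) ≡ a * c * (w * (1 + M))
    reassociate = solve-∀
    expand : ∀ w M → (2 * M + 3) * (w * (1 + M)) ≡ w + (2 * M + 1) * w * (2 + M)
    expand = solve-∀

∣-from : ∀ {l} u v N → u * N ≡ v * N + l → N ∣ l
∣-from u v N eq = ∣m+n∣m⇒∣n (subst (N ∣_) eq (n∣m*n u)) (n∣m*n v)

∣-positive⇒≤ : ∀ {m n} → 0 < n → m ∣ n → m ≤ n
∣-positive⇒≤ {n = suc n} _ = ∣⇒≤

-- With T = t + 1, the residues i ↦ (2 T + 1) i modulo 2 T² + 2 T + 1 have their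
-- closest points at distance 2 T + 1: they are the centres of the perfect
-- packing of the torus by discrete diamonds of radius T.
module Odd (t : ℕ) where

  T a M N : ℕ
  T = suc t
  a = 2 * t + 3
  M = 2 * t * t + 6 * t + 3
  N = 2 + M

  open Residue a N

  private
    -- The congruence is multiplied by `T`, and `T * a ≡ − suc T` modulo `N`.
    multiple-up : ∀ δ e q q′ → a * δ + q * N ≡ e + q′ * N → N ∣ suc T * δ + T * e
    multiple-up δ e q q′ eq = ∣-from (δ + T * q) (T * q′) N (begin
      (δ + T * q) * N                   ≡⟨ before t δ q ⟩
      T * (a * δ + q * N) + suc T * δ   ≡⟨ cong (λ u → T * u + suc T * δ) eq ⟩
      T * (e + q′ * N) + suc T * δ      ≡⟨ after T N δ e q′ ⟩
      T * q′ * N + (suc T * δ + T * e)  ∎)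
      where
      open ≡-Reasoning
      before : ∀ t δ q → (δ + suc t * q) * (2 + (2 * t * t + 6 * t + 3)) ≡
        suc t * ((2 * t + 3) * δ + q * (2 + (2 * t * t + 6 * t + 3))) + suc (suc t) * δ
      before = solve-∀
      after : ∀ T N δ e q′ → T * (e + q′ * N) + suc T * δ ≡ T * q′ * N + (suc T * δ + T * e)
      after = solve-∀

    -- The congruence is multiplied by `suc T`, and `suc T * a ≡ T` modulo `N`.
    multiple-down : ∀ δ e q q′ → a * δ + e + q * N ≡ q′ * N → N ∣ T * δ + suc T * e
    multiple-down δ e q q′ eq = ∣-from (suc T * q′) (δ + suc T * q) N (begin
      suc T * q′ * N                                ≡⟨ *-assoc (suc T) q′ N ⟩
      suc T * (q′ * N)                              ≡⟨ cong (suc T *_) eq ⟨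
      suc T * (a * δ + e + q * N)                   ≡⟨ after t δ e q ⟩
      (δ + suc T * q) * N + (T * δ + suc T * e)     ∎)
      where
      open ≡-Reasoning
      after : ∀ t δ e q → suc (suc t) * ((2 * t + 3) * δ + e + q * (2 + (2 * t * t + 6 * t + 3))) ≡
        (δ + suc (suc t) * q) * (2 + (2 * t * t + 6 * t + 3)) + (suc t * δ + suc (suc t) * e)
      after = solve-∀

    -- A positive multiple of `N` is at least `N`, which exceeds `suc T * (2 * T)` by one.
    from-multiple : ∀ δ e {l} → N ∣ l → 0 < l → l ≤ suc T * (δ + e) → 3 + 2 * t ≤ δ + e
    from-multiple δ e {l} N∣l 0<l le = *-cancelˡ-< (suc T) _ _ (begin-strict
      suc T * (2 + 2 * t)  <⟨ ≤-reflexive (eq t) ⟩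
      N                    ≤⟨ ∣-positive⇒≤ 0<l N∣l ⟩
      l                    ≤⟨ le ⟩
      suc T * (δ + e)      ∎)
      where
      open ≤-Reasoning
      eq : ∀ t → suc (suc (suc t) * (2 + 2 * t)) ≡ 2 + (2 * t * t + 6 * t + 3)
      eq = solve-∀

  far : FarApart (3 + 2 * t)
  far i (suc δ) e _ (inj₁ eq) with q , q′ , up ← step-up i (suc δ) e eq =
    from-multiple (suc δ) e (multiple-up (suc δ) e q q′ up) z<s
      (≤-trans (+-monoʳ-≤ (suc T * suc δ) (m≤n+m (T * e) e))
        (≤-reflexive (sym (*-distribˡ-+ (suc T) (suc δ) e))))
  far i (suc δ) e _ (inj₂ eq) with q , q′ , down ← step-down i (suc δ) e eq =
    from-multiple (suc δ) e (multiple-down (suc δ) e q q′ down) z<s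
      (≤-trans (+-monoˡ-≤ (suc T * e) (m≤n+m (T * suc δ) (suc δ)))
        (≤-reflexive (sym (*-distribˡ-+ (suc T) (suc δ) e))))

  onto : Onto
  onto = onto-from a a M (eq t)
    where
    eq : ∀ t → (2 * t + 3) * (2 * t + 3) ≡ 2 * (2 * t * t + 6 * t + 3) + 3
    eq = solve-∀

-- With T = t + 1, the residues i ↦ (2 T − 1) i modulo 2 T² form the lattice
-- spanned by (1, 2 T − 1) and (T, −T).
module Even (t : ℕ) where

  T a c M N : ℕ
  T = suc t
  a = 2 * t + 1
  c = 2 * t + 3
  M = 2 * t * t + 4 * t
  N = 2 + M

  open Residue a N

  private
    N≡ : N ≡ T * (2 * T)
    N≡ = eq t
      where
      eq : ∀ t → 2 + (2 * t * t + 4 * t) ≡ suc t * (2 * suc t)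
      eq = solve-∀

    a+1 : ∀ δ → a * δ + δ ≡ δ * (2 * T)
    a+1 = eq t
      where
      eq : ∀ t δ → (2 * t + 1) * δ + δ ≡ δ * (2 * suc t)
      eq = solve-∀

    -- `2 * T` divides `N`, and `a ≡ − 1` modulo `2 * T`.
    multiple-up : ∀ δ e q q′ → a * δ + q * N ≡ e + q′ * N → 2 * T ∣ δ + e
    multiple-up δ e q q′ eq = ∣-from (δ + q * T) (q′ * T) (2 * T) (begin
      (δ + q * T) * (2 * T)        ≡⟨ before δ q T (2 * T) ⟩
      δ * (2 * T) + q * (T * (2 * T)) ≡⟨ cong₂ (λ u v → u + q * v) (a+1 δ) N≡ ⟨
      a * δ + δ + q * N            ≡⟨ shuffle (a * δ) δ (q * N) ⟩
      a * δ + q * N + δ            ≡⟨ cong (_+ δ) eq ⟩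
      e + q′ * N + δ               ≡⟨ cong (λ u → e + q′ * u + δ) N≡ ⟩
      e + q′ * (T * (2 * T)) + δ   ≡⟨ after δ e q′ T (2 * T) ⟩
      q′ * T * (2 * T) + (δ + e)   ∎)
      where
      open ≡-Reasoning
      before : ∀ δ q T D → (δ + q * T) * D ≡ δ * D + q * (T * D)
      before = solve-∀
      shuffle : ∀ u v w → u + v + w ≡ u + w + v
      shuffle = solve-∀
      after : ∀ δ e q′ T D → e + q′ * (T * D) + δ ≡ q′ * T * D + (δ + e)
      after = solve-∀

    down : ∀ δ e q q′ → a * δ + e + q * N ≡ q′ * N → (δ + q * T) * (2 * T) + e ≡ q′ * T * (2 * T) + δ
    down δ e q q′ eq = begin
      (δ + q * T) * (2 * T) + e             ≡⟨ before δ e q T (2 * T) ⟩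
      δ * (2 * T) + e + q * (T * (2 * T))   ≡⟨ cong₂ (λ u v → u + e + q * v) (a+1 δ) N≡ ⟨
      a * δ + δ + e + q * N                 ≡⟨ shuffle (a * δ) δ e (q * N) ⟩
      a * δ + e + q * N + δ                 ≡⟨ cong (_+ δ) eq ⟩
      q′ * N + δ                            ≡⟨ cong (λ u → q′ * u + δ) N≡ ⟩
      q′ * (T * (2 * T)) + δ                ≡⟨ cong (_+ δ) (*-assoc q′ T (2 * T)) ⟨
      q′ * T * (2 * T) + δ                  ∎
      where
      open ≡-Reasoning
      before : ∀ δ e q T D → (δ + q * T) * D + e ≡ δ * D + e + q * (T * D)
      before = solve-∀
      shuffle : ∀ u v w z → u + v + w + z ≡ u + w + z + v
      shuffle = solve-∀

    -- Modulo `2 * T` the equation says `δ ≡ e`, so that distinct `δ` and `e` differ by at least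
    -- `2 * T`. If they are equal, cancelling `2 * T` in the exact equation shows that `T` divides
    -- `δ`.
    far-down : ∀ δ e q q′ → 0 < δ → (δ + q * T) * (2 * T) + e ≡ q′ * T * (2 * T) + δ → 2 * T ≤ δ + e
    far-down δ e q q′ 0<δ eq with <-cmp δ e
    ... | tri< δ<e _ _ = ≤-trans (∣-positive⇒≤ (m<n⇒0<n∸m δ<e)
            (∣-from (q′ * T) (δ + q * T) (2 * T) (+-cancelʳ-≡ δ _ _
              (trans (sym eq) (trans (cong (_+_ ((δ + q * T) * (2 * T))) (sym (m∸n+n≡m (<⇒≤ δ<e))))
                (sym (+-assoc ((δ + q * T) * (2 * T)) (e ∸ δ) δ)))))))
            (≤-trans (m∸n≤m e δ) (m≤n+m e δ))
    ... | tri> _ _ e<δ = ≤-trans (∣-positive⇒≤ (m<n⇒0<n∸m e<δ)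
            (∣-from (δ + q * T) (q′ * T) (2 * T) (+-cancelʳ-≡ e _ _
              (trans eq (trans (cong (_+_ (q′ * T * (2 * T))) (sym (m∸n+n≡m (<⇒≤ e<δ))))
                (sym (+-assoc (q′ * T * (2 * T)) (δ ∸ e) e)))))))
            (≤-trans (m∸n≤m δ e) (m≤m+n δ e))
    ... | tri≈ _ refl _ = +-mono-≤ T≤δ (≤-trans (≤-reflexive (+-identityʳ T)) T≤δ)
      where
      T≤δ : T ≤ δ
      T≤δ = ∣-positive⇒≤ 0<δ (∣-from q′ q T (trans
        (sym (*-cancelʳ-≡ (δ + q * T) (q′ * T) (2 * T) (+-cancelʳ-≡ δ _ _ eq))) (+-comm δ (q * T))))

  far : FarApart (2 * T)
  far i δ e 0<δ (inj₁ eq) with q , q′ , up ← step-up i δ e eq =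
    ∣-positive⇒≤ (<-≤-trans 0<δ (m≤m+n δ e)) (multiple-up δ e q q′ up)
  far i δ e 0<δ (inj₂ eq) with q , q′ , dn ← step-down i δ e eq =
    far-down δ e q q′ 0<δ (down δ e q q′ dn)

  onto : Onto
  onto = onto-from a c M (eq t)
    where
    eq : ∀ t → (2 * t + 1) * (2 * t + 3) ≡ 2 * (2 * t * t + 4 * t) + 3
    eq = solve-∀

halve : ∀ n → ∃ λ t → n ≡ 2 * t ⊎ n ≡ 1 + 2 * t
halve zero = 0 , inj₁ refl
halve (suc n) with halve n
... | t , inj₁ eq = t , inj₂ (cong suc eq)
... | t , inj₂ eq = suc t , inj₁ (trans (cong suc eq) (2*-suc t))
  where
  2*-suc : ∀ t → 2 + 2 * t ≡ 2 * suc t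
  2*-suc = solve-∀

spread-permutation : ∀ s n → 2 ≤ s → s * s ≤ 2 * n → ∃ λ (σ : Permutation′ n) → Spread s (σ ⟨$⟩ʳ_)
spread-permutation s n 2≤s s²≤2n with halve s
... | zero  , inj₁ refl = contradiction 2≤s λ ()
... | zero  , inj₂ refl = contradiction 2≤s λ { (s≤s ()) }
... | suc t , inj₁ refl = Residue.residue-permutation (Even.a t) (Even.N t) (Even.far t) (Even.onto t)
  (*-cancelˡ-≤ 2 (≤-trans (≤-reflexive (eq t)) s²≤2n))
  where
  eq : ∀ t → 2 * (2 + (2 * t * t + 4 * t)) ≡ (2 * suc t) * (2 * suc t)
  eq = solve-∀
-- Here `s * s` is odd, so that `s * s ≤ 2 * n` improves to `2 * N ≡ s * s + 1 ≤ 2 * n`.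
... | suc t , inj₂ refl = subst (λ s → ∃ λ (σ : Permutation′ n) → Spread s (σ ⟨$⟩ʳ_)) (s≡ t)
  (Residue.residue-permutation (Odd.a t) (Odd.N t) (Odd.far t) (Odd.onto t)
    (*-cancelˡ-< 2 _ _ (≤-trans (≤-reflexive (eq t)) s²≤2n)))
  where
  s≡ : ∀ t → 3 + 2 * t ≡ 1 + 2 * suc t
  s≡ = solve-∀
  eq : ∀ t → suc (2 * suc (2 * t * t + 6 * t + 3)) ≡ (1 + 2 * suc t) * (1 + 2 * suc t)
  eq = solve-∀

-- Separators have distant points

remove : Fin (suc n) → List (Fin (suc n)) → List (Fin n)
remove x []       = []
remove x (e ∷ es) with x Fin.≟ e
... | yes _  = remove x es
... | no x≢e = punchOut x≢e ∷ remove x es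

length-remove : (x : Fin (suc n)) → ∀ es → length (remove x es) ≤ length es
length-remove x []       = z≤n
length-remove x (e ∷ es) with x Fin.≟ e
... | yes _ = m≤n⇒m≤1+n (length-remove x es)
... | no  _ = s≤s (length-remove x es)

∉-remove⁺ : {x p : Fin (suc n)} (x≢p : x ≢ p) → ∀ {es} → All (p ≢_) es → All (punchOut x≢p ≢_) (remove x es)
∉-remove⁺ x≢p [] = []
∉-remove⁺ {x = x} x≢p {e ∷ es} (p≢e ∷ p∉es) with x Fin.≟ e
... | yes _  = ∉-remove⁺ x≢p p∉es
... | no x≢e = (p≢e ∘ Fin.punchOut-injective x≢p x≢e) ∷ ∉-remove⁺ x≢p p∉es

∉-remove⁻ : {x : Fin (suc n)} {y : Fin n} → ∀ es → All (y ≢_) (remove x es) → All (punchIn x y ≢_) es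
∉-remove⁻ [] [] = []
∉-remove⁻ {x = x} {y} (e ∷ es) y∉ with x Fin.≟ e
∉-remove⁻ {x = x} {y} (e ∷ es) y∉ | yes refl = Fin.punchInᵢ≢i x y ∷ ∉-remove⁻ es y∉
∉-remove⁻ {x = x} {y} (e ∷ es) (y≢ ∷ y∉) | no x≢e =
  (λ eq → y≢ (Fin.punchIn-injective x y _ (trans eq (sym (Fin.punchIn-punchOut x≢e))))) ∷ ∉-remove⁻ es y∉

punchIn-mono-< : (x : Fin (suc n)) {i j : Fin n} → i Fin.< j → punchIn x i Fin.< punchIn x j
punchIn-mono-< x {i} {j} i<j = ≰⇒> (λ le → <⇒≱ i<j (Fin.punchIn-cancel-≤ x j i le))

record Choice {k n : ℕ} (p : Fin n) (es : List (Fin n)) : Set where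
  constructor choice
  field
    {select}   : Fin k → Fin n
    increasing : ∀ {i j} → i Fin.< j → select i Fin.< select j
    index      : Fin k
    select-p   : select index ≡ p
    avoids     : ∀ j → All (select j ≢_) es

-- Deletes `d` points other than `p` one at a time, first those of `es`, whose remaining members are
-- renumbered by `remove`.
choose : ∀ d {k} (p : Fin (d + suc k)) es → length es ≤ d → All (p ≢_) es → Choice {suc k} p es
choose-after : ∀ d {k} (x p : Fin (suc (d + suc k))) es → x ≢ p → length es ≤ d → All (p ≢_) es →
               Choice {suc k} p (x ∷ es)

choose zero    p []       _        _           = choice (λ i<j → i<j) p refl (λ _ → [])
choose (suc d) p []       _        _           =
  choice increasing index select-p (λ _ → [])
  -- With `es` used up, any point other than `p` can be deleted; `punchIn p` supplies one.
  where open Choice (choose-after d (punchIn p (d ↑ʳ zero)) p [] (Fin.punchInᵢ≢i p _) z≤n [])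
choose (suc d) p (x ∷ es) (s≤s le) (p≢x ∷ p∉) = choose-after d x p es (p≢x ∘ sym) le p∉

choose-after d x p es x≢p le p∉ =
  choice (punchIn-mono-< x ∘ increasing) index
    (trans (cong (punchIn x) select-p) (Fin.punchIn-punchOut x≢p))
    (λ j → Fin.punchInᵢ≢i x _ ∷ ∉-remove⁻ es (avoids j))
  where
  open Choice (choose d (punchOut x≢p) (remove x es)
                (≤-trans (length-remove x es) le) (∉-remove⁺ x≢p p∉))

module Interior (X : Permutation′ n) where

  open Coordinate X

  between-covers : ∀ {p q z} (p<q : x p < x q) → x p < x z → x z < x q → ∃ λ t → between p<q t ≡ z
  between-covers {p} {q} {z} p<q p<z z<q = t , x-injective (begin
    x (between p<q t)                  ≡⟨ x-between p<q t ⟩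
    suc (x p) + toℕ t                  ≡⟨ cong (_+_ (suc (x p))) (Fin.toℕ-fromℕ< _) ⟩
    suc (x p) + (x z ∸ suc (x p))      ≡⟨ m+[n∸m]≡n p<z ⟩
    x z                                ∎)
    where
    open ≡-Reasoning
    t = fromℕ< (∸-monoˡ-< z<q p<z)

  interior : Fin n → Fin n → List (Fin n)
  interior p q with <-cmp (x p) (x q)
  ... | tri< p<q _ _ = List.tabulate (between p<q)
  ... | tri≈ _ _ _   = []
  ... | tri> _ _ q<p = List.tabulate (between q<p)

  length-interior : ∀ {p q} → p ≢ q → suc (length (interior p q)) ≡ ∣ x p - x q ∣
  length-interior {p} {q} p≢q with <-cmp (x p) (x q)
  ... | tri< p<q _ _ = trans (cong suc (List.length-tabulate (between p<q))) (sym (∣-∣-< p<q))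
  ... | tri≈ _ eq _  = contradiction (x-injective eq) p≢q
  ... | tri> _ _ q<p = trans (cong suc (List.length-tabulate (between q<p)))
                         (sym (trans (∣-∣-comm (x p) (x q)) (∣-∣-< q<p)))

  ∉-interior : ∀ p q → All (p ≢_) (interior p q)
  ∉-interior p q with <-cmp (x p) (x q)
  ... | tri< p<q _ _ = All.tabulate⁺ (λ t eq → <-irrefl (cong x eq) (between> p<q t))
  ... | tri≈ _ _ _   = []
  ... | tri> _ _ q<p = All.tabulate⁺ (λ t eq → <-irrefl (cong x (sym eq)) (between< q<p t))

  -- A point that is neither `q` nor between `p` and `q` lies on the same side of both.
  jump-> : ∀ {p q z} → All (z ≢_) (interior p q) → z ≢ q → x p < x z → x q < x z
  jump-> {p} {q} {z} z∉ z≢q p<z with <-cmp (x p) (x q)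
  ... | tri≈ _ eq _  = subst (_< x z) eq p<z
  ... | tri> _ _ q<p = <-trans q<p p<z
  ... | tri< p<q _ _ with <-cmp (x q) (x z)
  ...   | tri< q<z _ _ = q<z
  ...   | tri≈ _ eq _  = contradiction (sym (x-injective eq)) z≢q
  ...   | tri> _ _ z<q with t , eq ← between-covers p<q p<z z<q =
            contradiction (sym eq) (All.tabulate⁻ z∉ t)

  jump-< : ∀ {p q z} → All (z ≢_) (interior p q) → z ≢ q → x z < x p → x z < x q
  jump-< {p} {q} {z} z∉ z≢q z<p with <-cmp (x p) (x q)
  ... | tri≈ _ eq _  = subst (x z <_) eq z<p
  ... | tri< p<q _ _ = <-trans z<p p<q
  ... | tri> _ _ q<p with <-cmp (x z) (x q)
  ...   | tri< z<q _ _ = z<q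
  ...   | tri≈ _ eq _  = contradiction (x-injective eq) z≢q
  ...   | tri> _ _ q<z with t , eq ← between-covers q<p q<z z<p =
            contradiction (sym eq) (All.tabulate⁻ z∉ t)

sign-cong-< : ∀ {m n m′ n′} → (m < n → m′ < n′) → (m′ < n′ → m < n) →
              sign (+ m ℤ.- + n) ≡ sign (+ m′ ℤ.- + n′)
sign-cong-< {m} {n} to from with m <? n
... | yes m<n = trans (sign-< m<n) (sym (sign-< (to m<n)))
... | no m≮n  = trans (sign-≥ (≮⇒≥ m≮n)) (sym (sign-≥ (≮⇒≥ (m≮n ∘ from))))

module _ (σ : Permutation′ n) where

  private
    value : Fin n → ℕ
    value p = toℕ (σ ⟨$⟩ʳ p)

    module P = Interior (Permutation.id {n})
    module V = Interior σ

  -- The values at `a` and the pattern `π` are both ordered like `h`, hence like each other.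
  order-preserving⇒copy : {π : Permutation′ k} {a : Fin k → Fin n} (h : Fin k → ℕ) → Injective _≡_ _≡_ h →
    (∀ {i j} → i Fin.< j → a i Fin.< a j) →
    (∀ {i j} → h i < h j → value (a i) < value (a j)) →
    (∀ {i j} → h i < h j → toℕ (π ⟨$⟩ʳ i) < toℕ (π ⟨$⟩ʳ j)) → IsCopy π σ a
  order-preserving⇒copy {π = π} {a} h h-inj inc h→a h→π = record
    { increasing = inc
    ; sameSigns  = λ i j _ → sign-cong-<
        (h→π ∘ mono⇒reflects-< h (value ∘ a) h-inj h→a)
        (h→a ∘ mono⇒reflects-< h (λ i → toℕ (π ⟨$⟩ʳ i)) h-inj h→π)
    }

  -- p can be exchanged for q without affecting the pattern as soon as no
  -- selected point lies strictly between them in position or in value.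
  exchange : {p q : Fin n} → Choice {k} p (q ∷ P.interior p q ++ V.interior p q) →
             (∀ (π : Permutation′ k) → AtMostOneCopy π σ) → p ≡ q
  exchange {k} {p} {q} (choice {a} inc i₀ ai₀≡p avoid) atMostOne =
    trans (sym ai₀≡p) (trans (atMostOne π a b a-copy b-copy i₀) b-i₀)
    where
    h : Fin k → ℕ
    h = value ∘ a

    h-injective : Injective _≡_ _≡_ h
    h-injective = increasing⇒injective inc ∘ Coordinate.x-injective σ

    π : Permutation′ k
    π = proj₁ (standardize h h-injective)

    b : Fin k → Fin n
    b j with j Fin.≟ i₀
    ... | yes _ = q
    ... | no  _ = a j

    b-i₀ : b i₀ ≡ q
    b-i₀ with i₀ Fin.≟ i₀
    ... | yes _ = refl
    ... | no ≢ = contradiction refl ≢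

    a≢q : ∀ j → a j ≢ q
    a≢q j = All.head (avoid j)

    outsideᴾ : ∀ j → All (a j ≢_) (P.interior p q)
    outsideᴾ j = All.++⁻ˡ (P.interior p q) (All.tail (avoid j))

    outsideⱽ : ∀ j → All (a j ≢_) (V.interior p q)
    outsideⱽ j = All.++⁻ʳ (P.interior p q) (All.tail (avoid j))

    module _ (X : Permutation′ n) (outside : ∀ j → All (a j ≢_) (Interior.interior X p q)) where

      open Coordinate X
      open Interior X

      b-mono : ∀ {i j} → x (a i) < x (a j) → x (b i) < x (b j)
      b-mono {i} {j} lt with i Fin.≟ i₀ | j Fin.≟ i₀
      ... | yes refl | yes refl = contradiction lt (<-irrefl refl)
      ... | yes refl | no  _    = jump-> (outside j) (a≢q j) (subst (λ z → x z < x (a j)) ai₀≡p lt)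
      ... | no  _    | yes refl = jump-< (outside i) (a≢q i) (subst (λ z → x (a i) < x z) ai₀≡p lt)
      ... | no  _    | no  _    = lt

    a-copy : IsCopy π σ a
    a-copy = order-preserving⇒copy h h-injective inc (λ lt → lt) (proj₂ (standardize h h-injective))

    b-copy : IsCopy π σ b
    b-copy = order-preserving⇒copy h h-injective
      (b-mono (Permutation.id {n}) outsideᴾ ∘ inc) (b-mono σ outsideⱽ)
      (proj₂ (standardize h h-injective))

-- Besides `q`, each interior has one point fewer than the distance in its coordinate. At
-- ℓ¹-distance at most `d + 1` these are at most `d` points, so that they can all be avoided and
-- `exchange` applies.
separator⇒spread : (σ : Permutation′ (d + suc k)) → (∀ (π : Permutation′ (suc k)) → AtMostOneCopy π σ) →
                   Spread (2 + d) (σ ⟨$⟩ʳ_)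
separator⇒spread {d} {k} σ atMostOne {p} {q} p≢q = ≮⇒≥ λ close →
  p≢q (exchange σ (choose d p (q ∷ P.interior p q ++ V.interior p q) (few close)
    (p≢q ∷ All.++⁺ (P.∉-interior p q) (V.∉-interior p q))) atMostOne)
  where
  module P = Interior (Permutation.id {d + suc k})
  module V = Interior σ
  both : ∀ {l m u v} → suc l ≡ u → suc m ≡ v → u + v < 2 + d → suc (l + m) ≤ d
  both {l} {m} refl refl lt = s≤s⁻¹ (s≤s⁻¹ (subst (λ w → suc (suc w) ≤ 2 + d) (+-suc l m) lt))
  few : ∣ toℕ p - toℕ q ∣ + ∣ toℕ (σ ⟨$⟩ʳ p) - toℕ (σ ⟨$⟩ʳ q) ∣ < 2 + d →
        suc (length (P.interior p q ++ V.interior p q)) ≤ d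
  few close = subst (λ l → suc l ≤ d) (sym (List.length-++ (P.interior p q)))
    (both (P.length-interior p≢q) (V.length-interior p≢q) close)

-- Distant points need a long permutation

-- Intervals of half-length `f i` about `2 * i` do not overlap; empty ones are exempt, as they may
-- lie inside others.
Separated : (Fin n → ℕ) → Set
Separated f = ∀ {i j} → toℕ i < toℕ j → 0 < f i → 0 < f j → 2 * toℕ i + (f i + f j) ≤ 2 * toℕ j

-- f i is half the length of an interval centred at 2 (o + i) + C: these intervals are
-- disjoint and lie between M and B.
packing : (f : Fin n → ℕ) → Separated f → ∀ C o M B → M ≤ B →
          (∀ j → 0 < f j → M + f j ≤ 2 * (o + toℕ j) + C) →
          (∀ j → 0 < f j → 2 * (o + toℕ j) + f j + C ≤ B) →
          M + 2 * sum f ≤ B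
packing {zero} f sep C o M B M≤B after before = ≤-trans (≤-reflexive (+-identityʳ M)) M≤B
packing {suc n} f sep C o M B M≤B after before = by-first (f zero) refl
  where
  open ≤-Reasoning
  f′ : Fin n → ℕ
  f′ = f ∘ suc
  sep′ : Separated f′
  sep′ {i} {j} i<j pi pj = ≤-from 0 (sep (s≤s i<j) pi pj) (eq (toℕ i) (f′ i) (f′ j) (toℕ j))
    where
    eq : ∀ i u v j → 2 * i + (u + v) + 2 * suc j + 0 ≡ 2 * j + (2 * suc i + (u + v))
    eq = solve-∀
  before′ : ∀ j → 0 < f′ j → 2 * (suc o + toℕ j) + f′ j + C ≤ B
  before′ j pj = subst (λ l → 2 * l + f′ j + C ≤ B) (+-suc o (toℕ j)) (before (suc j) pj)
  -- An empty first interval leaves `M` as it is; otherwise its right end takes the place of `M`.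
  by-first : ∀ w → f zero ≡ w → M + 2 * (f zero + sum f′) ≤ B
  by-first zero eq rewrite eq = packing f′ sep′ C (suc o) M B M≤B
    (λ j pj → subst (λ l → M + f′ j ≤ 2 * l + C) (+-suc o (toℕ j)) (after (suc j) pj)) before′
  by-first (suc w) eq = begin
    M + 2 * (f zero + sum f′)
      ≤⟨ ≤-from 0 (after zero p₀) (rearranged M (f zero) (sum f′) o C) ⟩
    2 * (o + 0) + f zero + C + 2 * sum f′
      ≤⟨ packing f′ sep′ C (suc o) (2 * (o + 0) + f zero + C) B (before zero p₀) after′ before′ ⟩
    B ∎
    where
    p₀ : 0 < f zero
    p₀ = subst (0 <_) (sym eq) z<s
    rearranged : ∀ M w S o C → M + 2 * (w + S) + (2 * (o + 0) + C) + 0 ≡ 2 * (o + 0) + w + C + 2 * S + (M + w)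
    rearranged = solve-∀
    after′ : ∀ j → 0 < f′ j → 2 * (o + 0) + f zero + C + f′ j ≤ 2 * (suc o + toℕ j) + C
    after′ j pj = ≤-from 0 (sep z<s p₀ pj) (eq′ o (f zero) C (f′ j) (toℕ j))
      where
      eq′ : ∀ o w C v j → 2 * (o + 0) + w + C + v + 2 * suc j + 0 ≡ 2 * (suc o + j) + C + (2 * 0 + (w + v))
      eq′ = solve-∀

-- Shifting the centres by `C` places all intervals between `0` and `2 * n + 2 * C`.
packing-bound : (f : Fin (suc n) → ℕ) → Separated f → ∀ C → (∀ i → f i ≤ C) → 2 * sum f ≤ 2 * n + 2 * C
packing-bound {n} f sep C f≤C = packing f sep C 0 0 (2 * n + 2 * C) z≤n
  (λ j _ → ≤-trans (f≤C j) (m≤n+m C (2 * toℕ j)))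
  (λ j _ → begin
    2 * toℕ j + f j + C  ≤⟨ +-monoˡ-≤ C (+-mono-≤ (*-monoʳ-≤ 2 (Fin.toℕ≤pred[n] j)) (f≤C j)) ⟩
    2 * n + C + C        ≡⟨ eq n C ⟩
    2 * n + 2 * C        ∎)
  where
  open ≤-Reasoning
  eq : ∀ n C → 2 * n + C + C ≡ 2 * n + 2 * C
  eq = solve-∀

-- Half-length of the interval carried by position `i`, for `s = suc c`; by truncation it vanishes
-- from position `s` on.
weight : ℕ → ℕ → ℕ
weight c i = suc c ∸ ∣ 2 * i - c ∣

weights : ℕ → ℕ → ℕ → ℕ
weights c o n = sum {n} (λ i → weight c (o + toℕ i))

weights-++ : ∀ c o m n → weights c o (m + n) ≡ weights c o m + weights c (o + m) n
weights-++ c o zero    n = cong (λ o → weights c o n) (sym (+-identityʳ o))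
weights-++ c o (suc m) n = begin
  weight c (o + 0) + sum {m + n} (λ i → weight c (o + suc (toℕ i)))
    ≡⟨ cong (_+_ (weight c (o + 0))) (shift (m + n)) ⟩
  weight c (o + 0) + weights c (suc o) (m + n)
    ≡⟨ cong (_+_ (weight c (o + 0))) (weights-++ c (suc o) m n) ⟩
  weight c (o + 0) + (weights c (suc o) m + weights c (suc o + m) n)
    ≡⟨ +-assoc (weight c (o + 0)) _ _ ⟨
  weight c (o + 0) + weights c (suc o) m + weights c (suc o + m) n
    ≡⟨ cong₂ _+_ (cong (_+_ (weight c (o + 0))) (sym (shift m)))
                 (cong (λ o → weights c o n) (sym (+-suc o m))) ⟩
  weights c o (suc m) + weights c (o + suc m) n ∎
  where
  open ≡-Reasoning
  shift : ∀ n → sum {n} (λ i → weight c (o + suc (toℕ i))) ≡ weights c (suc o) n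
  shift n = sum-cong-≗ {n} (λ i → cong (weight c) (+-suc o (toℕ i)))

weight-left : ∀ {c i} → 2 * i ≤ c → weight c i ≡ 1 + 2 * i
weight-left {c} {i} 2i≤c = begin
  suc c ∸ ∣ 2 * i - c ∣                  ≡⟨ cong (suc c ∸_) (m≤n⇒∣m-n∣≡n∸m 2i≤c) ⟩
  suc c ∸ (c ∸ 2 * i)                    ≡⟨ +-∸-assoc 1 (m∸n≤m c (2 * i)) ⟩
  suc (c ∸ (c ∸ 2 * i))                  ≡⟨ cong suc (m∸[m∸n]≡n 2i≤c) ⟩
  1 + 2 * i                              ∎
  where open ≡-Reasoning

weight-right : ∀ {c i e w} → 2 * i ≡ c + e → suc c ≡ w + e → weight c i ≡ w
weight-right {c} {i} {e} {w} 2i≡ c≡ = begin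
  suc c ∸ ∣ 2 * i - c ∣  ≡⟨ cong₂ _∸_ c≡ (trans (cong ∣_- c ∣ 2i≡) (trans (∣-∣-comm (c + e) c) (∣m-m+n∣≡n c e))) ⟩
  w + e ∸ e              ≡⟨ m+n∸n≡m w e ⟩
  w                      ∎
  where open ≡-Reasoning

-- The summand `m` on the left avoids a subtraction; the induction needs a general `e`.
sum-ascending : ∀ m e → sum {m} (λ i → e + 2 * toℕ i) + m ≡ m * e + m * m
sum-ascending zero    e = refl
sum-ascending (suc m) e = begin
  e + 0 + sum {m} (λ i → e + 2 * suc (toℕ i)) + suc m
    ≡⟨ cong (λ S → e + 0 + S + suc m) (sum-cong-≗ {m} (λ i → step e (toℕ i))) ⟩
  e + 0 + sum {m} (λ i → 2 + e + 2 * toℕ i) + suc m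
    ≡⟨ before e (sum {m} (λ i → 2 + e + 2 * toℕ i)) m ⟩
  sum {m} (λ i → 2 + e + 2 * toℕ i) + m + suc e
    ≡⟨ cong (_+ suc e) (sum-ascending m (2 + e)) ⟩
  m * (2 + e) + m * m + suc e
    ≡⟨ after m e ⟩
  suc m * e + suc m * suc m ∎
  where
  open ≡-Reasoning
  step : ∀ e i → e + 2 * suc i ≡ 2 + e + 2 * i
  step = solve-∀
  before : ∀ e S m → e + 0 + S + suc m ≡ S + m + suc e
  before = solve-∀
  after : ∀ m e → m * (2 + e) + m * m + suc e ≡ suc m * e + suc m * suc m
  after = solve-∀

sum-descending : ∀ m → sum {m} (λ i → 1 + 2 * (m ∸ suc (toℕ i))) ≡ m * m
sum-descending zero    = refl
sum-descending (suc m) = trans (cong (_+_ (1 + 2 * m)) (sum-descending m)) (square m)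
  where
  square : ∀ m → 1 + 2 * m + m * m ≡ suc m * suc m
  square = solve-∀

weights-left : ∀ c m → 2 * m ≤ 2 + c → weights c 0 m ≡ m * m
weights-left c m 2m≤ = +-cancelʳ-≡ m _ _ (begin
  weights c 0 m + m                    ≡⟨ cong (_+ m) (sum-cong-≗ {m} (λ i → weight-left {c} {toℕ i} (left-half i))) ⟩
  sum {m} (λ i → 1 + 2 * toℕ i) + m    ≡⟨ sum-ascending m 1 ⟩
  m * 1 + m * m                        ≡⟨ swap m ⟩
  m * m + m                            ∎)
  where
  open ≡-Reasoning
  swap : ∀ m → m * 1 + m * m ≡ m * m + m
  swap = solve-∀
  left-half : (i : Fin m) → 2 * toℕ i ≤ c
  left-half i = ≤-from 0 (≤-trans (*-monoʳ-≤ 2 (Fin.toℕ<n i)) 2m≤) (eq (toℕ i) c)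
    where
    eq : ∀ i c → 2 * i + (2 + c) + 0 ≡ c + 2 * suc i
    eq = solve-∀

weights-right : ∀ c o m → o + m ≡ suc c → suc c ≤ 2 * o → weights c o m ≡ m * m
weights-right c o m o+m≡ c<2o = trans (sum-cong-≗ {m} pointwise) (sum-descending m)
  where
  pointwise : ∀ (i : Fin m) → weight c (o + toℕ i) ≡ 1 + 2 * (m ∸ suc (toℕ i))
  pointwise i = weight-right {c} {o + toℕ i} {2 * (o + toℕ i) ∸ c} (sym (m+[n∸m]≡n c≤))
   (+-cancelˡ-≡ c _ _ (begin
    c + suc c                                       ≡⟨ cong (λ c → c + suc c) c≡ ⟩
    (o + toℕ i + l) + suc (o + toℕ i + l)           ≡⟨ before (o + toℕ i) l ⟩
    1 + 2 * l + 2 * (o + toℕ i)                     ≡⟨ cong (_+_ (1 + 2 * l)) (m+[n∸m]≡n c≤) ⟨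
    1 + 2 * l + (c + (2 * (o + toℕ i) ∸ c))         ≡⟨ after l c (2 * (o + toℕ i) ∸ c) ⟩
    c + (1 + 2 * l + (2 * (o + toℕ i) ∸ c))         ∎))
    where
    open ≡-Reasoning
    l : ℕ
    l = m ∸ suc (toℕ i)
    c≤ : c ≤ 2 * (o + toℕ i)
    c≤ = ≤-trans (n≤1+n c) (≤-trans c<2o (*-monoʳ-≤ 2 (m≤m+n o (toℕ i))))
    before : ∀ u l → (u + l) + suc (u + l) ≡ 1 + 2 * l + 2 * u
    before = solve-∀
    after : ∀ l c e → 1 + 2 * l + (c + e) ≡ c + (1 + 2 * l + e)
    after = solve-∀
    move : ∀ o i l → o + (suc i + l) ≡ suc (o + i + l)
    move = solve-∀
    c≡ : c ≡ o + toℕ i + l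
    c≡ = suc-injective (trans (sym o+m≡)
      (trans (cong (_+_ o) (sym (m+[n∸m]≡n (Fin.toℕ<n i)))) (move o (toℕ i) l)))

-- The first `o` weights are the odd numbers going up from 1, the next `m` are odd numbers going
-- down to 1, and both sums are squares. The bounds make `o` half of `suc c`, rounded up.
weights-total : ∀ c o m n → o + m ≡ suc c → suc c ≤ 2 * o → 2 * o ≤ 2 + c → suc c ≤ n →
                o * o + m * m ≤ weights c 0 n
weights-total c o m n o+m≡ c<2o 2o≤ c<n = begin
  o * o + m * m                                 ≡⟨ cong₂ _+_ (weights-left c o 2o≤) (weights-right c o m o+m≡ c<2o) ⟨
  weights c 0 o + weights c o m                 ≡⟨ weights-++ c 0 o m ⟨
  weights c 0 (o + m)                           ≤⟨ m≤m+n _ (weights c (o + m) (n ∸ (o + m))) ⟩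
  weights c 0 (o + m) + weights c (o + m) (n ∸ (o + m))
                                                ≡⟨ weights-++ c 0 (o + m) (n ∸ (o + m)) ⟨
  weights c 0 (o + m + (n ∸ (o + m)))           ≡⟨ cong (weights c 0) (m+[n∸m]≡n (subst (_≤ n) (sym o+m≡) c<n)) ⟩
  weights c 0 n                                 ∎
  where open ≤-Reasoning

-- Positive weights are not truncated. By the triangle inequality through `c` they add up to at most
-- `2 * suc c` less `2 * ∣ p - q ∣`, hence to at most `2 * ∣ u - v ∣`.
weight-separated : ∀ {c p q u v} → u < v → suc c ≤ ∣ p - q ∣ + ∣ u - v ∣ →
                   0 < weight c p → 0 < weight c q → 2 * u + (weight c p + weight c q) ≤ 2 * v
weight-separated {c} {p} {q} {u} {v} u<v far wp wq =
  ≤-from 0 (+-mono-≤ (+-mono-≤ (+-mono-≤ (complement p wp) (complement q wq)) (+-mono-≤ far far))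
             (+-mono-≤ triangle (+-mono-≤ rise rise)))
    (eq u (weight c p) (weight c q) v c ∣ p - q ∣ ∣ u - v ∣ A B)
  where
  open ≤-Reasoning
  A B : ℕ
  A = ∣ 2 * p - c ∣
  B = ∣ 2 * q - c ∣
  complement : ∀ r → 0 < weight c r → weight c r + ∣ 2 * r - c ∣ ≤ suc c
  complement r pos = ≤-reflexive (m∸n+n≡m
    (<⇒≤ (m∸n≢0⇒n<m {suc c} {∣ 2 * r - c ∣} (λ eq → <-irrefl (sym eq) pos))))
  triangle : 2 * ∣ p - q ∣ ≤ A + B
  triangle = begin
    2 * ∣ p - q ∣          ≡⟨ *-distribˡ-∣-∣ 2 p q ⟩
    ∣ 2 * p - 2 * q ∣      ≤⟨ ∣-∣-triangle (2 * p) c (2 * q) ⟩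
    A + ∣ c - 2 * q ∣      ≡⟨ cong (_+_ A) (∣-∣-comm c (2 * q)) ⟩
    A + B                  ∎
  rise : ∣ u - v ∣ + u ≤ v
  rise = ≤-reflexive (trans (cong (_+ u) (m≤n⇒∣m-n∣≡n∸m (<⇒≤ u<v))) (m∸n+n≡m (<⇒≤ u<v)))
  eq : ∀ u w z v c P U A B →
    2 * u + (w + z) + ((suc c + suc c) + ((P + U) + (P + U)) + ((A + B) + (v + v))) + 0 ≡
    2 * v + (((w + A) + (z + B)) + (suc c + suc c) + (2 * P + ((U + u) + (U + u))))
  eq = solve-∀

module _ {c : ℕ} (σ : Permutation′ (suc n)) (spread : Spread (suc c) (σ ⟨$⟩ʳ_)) where

  private
    row-weight : Fin (suc n) → ℕ
    row-weight v = weight c (toℕ (σ ⟨$⟩ˡ v))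

    row-separated : Separated row-weight
    row-separated {u} {v} u<v = weight-separated {c} {toℕ (σ ⟨$⟩ˡ u)} {toℕ (σ ⟨$⟩ˡ v)} u<v
      (subst (λ w → suc c ≤ ∣ toℕ (σ ⟨$⟩ˡ u) - toℕ (σ ⟨$⟩ˡ v) ∣ + w)
        (cong₂ (λ a b → ∣ toℕ a - toℕ b ∣) (inverseʳ σ) (inverseʳ σ))
        (spread λ eq → <-irrefl (cong toℕ (trans (sym (inverseʳ σ))
          (trans (cong (σ ⟨$⟩ʳ_) eq) (inverseʳ σ)))) u<v))

    rows-total : sum row-weight ≡ weights c 0 (suc n)
    rows-total = trans (sum-permute row-weight σ)
      (sum-cong-≗ {suc n} (λ i → cong (λ j → weight c (toℕ j)) (inverseˡ σ {i})))

    weights-bound : ∀ C → (∀ i → weight c i ≤ C) → 2 * weights c 0 (suc n) ≤ 2 * n + 2 * C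
    weights-bound C w≤C = subst (λ w → 2 * w ≤ 2 * n + 2 * C) rows-total
      (packing-bound row-weight row-separated C (λ i → w≤C (toℕ (σ ⟨$⟩ˡ i))))

    total-bound : ∀ C → (∀ i → weight c i ≤ C) → ∀ o m → o + m ≡ suc c → suc c ≤ 2 * o → 2 * o ≤ 2 + c →
                  suc c ≤ suc n → 2 * (o * o + m * m) ≤ 2 * n + 2 * C
    total-bound C w≤C o m o+m≡ c<2o 2o≤ c<n =
      ≤-trans (*-monoʳ-≤ 2 (weights-total c o m (suc n) o+m≡ c<2o 2o≤ c<n)) (weights-bound C w≤C)

    even-long : ∀ t → c ≡ 2 * t → suc c ≤ suc n → c * c + 2 ≤ 2 * suc n
    even-long t refl c<n = ≤-from 0
      (total-bound (suc c) (λ i → m∸n≤m (suc c) ∣ 2 * i - c ∣) (suc t) t (halves t)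
        (≤-trans (n≤1+n (suc c)) (≤-reflexive (double t))) (≤-reflexive (sym (double t))) c<n)
      (eq t n)
      where
      halves : ∀ t → suc t + t ≡ suc (2 * t)
      halves = solve-∀
      double : ∀ t → 2 + 2 * t ≡ 2 * suc t
      double = solve-∀
      eq : ∀ t n → 2 * t * (2 * t) + 2 + (2 * n + 2 * suc (2 * t)) + 0 ≡
                   2 * suc n + 2 * (suc t * suc t + t * t)
      eq = solve-∀

    odd-long : ∀ t → c ≡ 1 + 2 * t → suc c ≤ suc n → c * c + 2 ≤ 2 * suc n
    odd-long t refl c<n = ≤-from 1
      -- As `c` is odd, `2 * i` never equals `c`, which improves the bound on the weights from
      -- `suc c` to `c`.
      (total-bound c (λ i → m≤n+o⇒m∸n≤o (suc c) ∣ 2 * i - c ∣ (+-monoˡ-≤ c (off-centre i))) (suc t) (suc t)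
        (halves t) (≤-reflexive (double t)) (≤-trans (≤-reflexive (sym (double t))) (n≤1+n (suc c))) c<n)
      (eq t n)
      where
      off-centre : ∀ i → 1 ≤ ∣ 2 * i - c ∣
      off-centre i = n≢0⇒n>0 (λ eq → even≢odd i t (∣m-n∣≡0⇒m≡n eq))
      halves : ∀ t → suc t + suc t ≡ suc (1 + 2 * t)
      halves = solve-∀
      double : ∀ t → 2 + 2 * t ≡ 2 * suc t
      double = solve-∀
      eq : ∀ t n → (1 + 2 * t) * (1 + 2 * t) + 2 + (2 * n + 2 * (1 + 2 * t)) + 1 ≡
                   2 * suc n + 2 * (suc t * suc t + suc t * suc t)
      eq = solve-∀

  spread⇒long : suc c ≤ suc n → c * c + 2 ≤ 2 * suc n
  spread⇒long with halve c
  ... | t , inj₁ eq = even-long t eq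
  ... | t , inj₂ eq = odd-long t eq

-- The finite search and the maximal length

SpreadPermutation : ℕ → ℕ → Set
SpreadPermutation s n = ∃ λ (σ : Permutation′ n) → Spread s (σ ⟨$⟩ʳ_)

-- All functions are enumerated by their codes; the condition `f p ≢ f q` singles out the
-- permutations.
spreadPermutation? : ∀ s n → Dec (SpreadPermutation s n)
spreadPermutation? s n = map′ decode encode (Fin.any? λ c → good? (Fin.finToFun {n} {n} c))
  where
  Good : (Fin n → Fin n) → Set
  Good f = ∀ p q → p ≢ q → f p ≢ f q × s ≤ ∣ toℕ p - toℕ q ∣ + ∣ toℕ (f p) - toℕ (f q) ∣

  good? : ∀ f → Dec (Good f)
  good? f = Fin.all? λ p → Fin.all? λ q →
    ¬? (p Fin.≟ q) →-dec ¬? (f p Fin.≟ f q) ×-dec s ≤? ∣ toℕ p - toℕ q ∣ + ∣ toℕ (f p) - toℕ (f q) ∣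

  decode : (∃ λ c → Good (Fin.finToFun {n} {n} c)) → SpreadPermutation s n
  decode (c , good)
    with σ , σ≗ ← injective⇒permutation (Fin.finToFun c)
                    (λ {p} {q} eq → decidable-stable (p Fin.≟ q) (λ p≢q → proj₁ (good p q p≢q) eq)) =
    σ , λ {p} {q} p≢q → subst₂ (λ u v → s ≤ ∣ toℕ p - toℕ q ∣ + ∣ toℕ u - toℕ v ∣)
      (sym (σ≗ p)) (sym (σ≗ q)) (proj₂ (good p q p≢q))

  encode : SpreadPermutation s n → ∃ λ c → Good (Fin.finToFun {n} {n} c)
  encode (σ , spread) = Fin.funToFin (σ ⟨$⟩ʳ_) , λ p q p≢q →
    subst₂ (λ u v → u ≢ v × s ≤ ∣ toℕ p - toℕ q ∣ + ∣ toℕ u - toℕ v ∣)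
      (sym (Fin.finToFun-funToFin (σ ⟨$⟩ʳ_) p)) (sym (Fin.finToFun-funToFin (σ ⟨$⟩ʳ_) q))
      ((p≢q ∘ Coordinate.x-injective σ ∘ cong toℕ) , spread p≢q)

separatorLength⇒spread : ∀ {k m} → 1 ≤ k → IsSeparatorLength k m →
                         ∃ λ d → m ≡ d + k × SpreadPermutation (2 + d) m
separatorLength⇒spread {suc k} {m} _ (σ , k≤m , atMostOne) =
  go (m ∸ suc k) (sym (m∸n+n≡m k≤m)) σ atMostOne
  where
  go : ∀ d {m} → m ≡ d + suc k → (σ : Permutation′ m) → (∀ (π : Permutation′ (suc k)) → AtMostOneCopy π σ) →
       ∃ λ d → m ≡ d + suc k × SpreadPermutation (2 + d) m
  go d refl σ atMostOne = d , refl , σ , separator⇒spread σ atMostOne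

-- This is `spread⇒long` at `c = suc d`; `2 ≤ k` ensures that there are `2 + d` positions.
spreadPermutation⇒square-≤ : ∀ {d k} → 2 ≤ k → SpreadPermutation (2 + d) (d + k) → d * d + 3 ≤ 2 * k
spreadPermutation⇒square-≤ {d} {k} 2≤k (σ , spread) = go refl σ spread
  where
  go : ∀ {n} → n ≡ d + k → (σ : Permutation′ n) → Spread (2 + d) (σ ⟨$⟩ʳ_) → d * d + 3 ≤ 2 * k
  go {zero}  eq _ _ = contradiction (trans eq (+-comm d k)) (<⇒≢ (<-≤-trans z<s (≤-trans 2≤k (m≤m+n k d))))
  go {suc n} eq σ spread = ≤-from 0
    (subst (λ n → suc d * suc d + 2 ≤ 2 * n) eq (spread⇒long {c = suc d} σ spread c<n))
    (ring d k)
    where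
    c<n : 2 + d ≤ suc n
    c<n = subst (2 + d ≤_) (sym eq) (≤-trans (≤-reflexive (+-comm 2 d)) (+-monoʳ-≤ d 2≤k))
    ring : ∀ d k → d * d + 3 + 2 * (d + k) + 0 ≡ 2 * k + (suc d * suc d + 2)
    ring = solve-∀

square-cancel-< : ∀ {m n} → m * m < n * n → m < n
square-cancel-< m²<n² = ≰⇒> λ n≤m → <⇒≱ m²<n² (*-mono-≤ n≤m n≤m)

Conclusion : ℕ → ℕ → Set
Conclusion k r = ∃[ n ] (IsMaxSeparatorLength k n ×
  (∃[ ε ] ((ε ≡ -1ℤ ⊎ ε ≡ 0ℤ) × + n ≡ + k ℤ.+ + r ℤ.+ ε)))

module _ {k r : ℕ} (2≤k : 2 ≤ k) (r-floor : IsFloorSqrt (2 * k ∸ 3) r) where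

  private
    1≤k : 1 ≤ k
    1≤k = ≤-trans (n≤1+n 1) 2≤k

    4≤2k : 4 ≤ 2 * k
    4≤2k = *-monoʳ-≤ 2 2≤k

    excess-≤ : ∀ {m} → IsSeparatorLength k m → ∃ λ d → d ≤ r × m ≡ d + k × SpreadPermutation (2 + d) m
    excess-≤ len with d , refl , spread ← separatorLength⇒spread 1≤k len =
      d , s≤s⁻¹ (square-cancel-< (≤-<-trans
            (m+n≤o⇒m≤o∸n (d * d) (spreadPermutation⇒square-≤ 2≤k spread)) (proj₂ r-floor))) ,
      refl , spread

    spread⇒length : ∀ d → SpreadPermutation (2 + d) (d + k) → IsSeparatorLength k (d + k)
    spread⇒length d (σ , spread) = σ , spread⇒separator σ (m≤n+m k d) (≤-reflexive (+-comm d k)) spread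

    -- For `s = 2 + r′` and `n = r′ + k`, the condition `s * s ≤ 2 * n` is `r * r + 3 ≤ 2 * k`
    -- rearranged.
    smaller-spread : ∀ {r′} → r ≡ suc r′ → SpreadPermutation (2 + r′) (r′ + k)
    smaller-spread {r′} refl = spread-permutation (2 + r′) (r′ + k) (s≤s (s≤s z≤n))
      (≤-from 0 (m≤o∸n⇒m+n≤o (suc r′ * suc r′) (≤-trans (n≤1+n 3) 4≤2k) (proj₁ r-floor)) (ring r′ k))
      where
      ring : ∀ r k → (2 + r) * (2 + r) + 2 * k + 0 ≡ 2 * (r + k) + (suc r * suc r + 3)
      ring = solve-∀

    r-positive : r ≢ 0
    r-positive refl = <⇒≱ (proj₂ r-floor) (m+n≤o⇒m≤o∸n 1 4≤2k)

  conclusion : Conclusion k r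
  conclusion with spreadPermutation? (2 + r) (r + k)
  ... | yes sp = r + k , (spread⇒length r sp , upper) , 0ℤ , inj₂ refl ,
    trans (cong +_ (+-comm r k)) (sym (ℤ.+-identityʳ (+ (k + r))))
    where
    upper : ∀ m → IsSeparatorLength k m → m ≤ r + k
    upper m len with d , d≤r , refl , _ ← excess-≤ len = +-monoˡ-≤ k d≤r
  ... | no ¬sp = by-predecessor r refl
    where
    by-predecessor : ∀ s → r ≡ s → Conclusion k s
    by-predecessor zero     r≡0 = contradiction r≡0 r-positive
    by-predecessor (suc r′) r≡ = r′ + k , (spread⇒length r′ (smaller-spread r≡) , upper) , -1ℤ , inj₁ refl ,
      cong (λ s → + s ℤ.+ -1ℤ) (trans (cong suc (+-comm r′ k)) (sym (+-suc k r′)))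
      where
      upper : ∀ m → IsSeparatorLength k m → m ≤ r′ + k
      upper m len with d , d≤r , refl , sp ← excess-≤ len =
        -- The excess `d` is at most `r`, and `¬sp` excludes `r` itself.
        +-monoˡ-≤ k (s≤s⁻¹ (subst (d <_) r≡ (≤∧≢⇒< d≤r λ { refl → ¬sp sp })))

theorem1p2 : (k : ℕ) → 2 ≤ k →
    ∃[ n ] (IsMaxSeparatorLength k n ×
    (∃[ ε ] ((ε ≡ -1ℤ ⊎ ε ≡ 0ℤ) ×
    + n ≡ + k ℤ.+ + ⌊√ 2 * k ∸ 3 ⌋ ℤ.+ ε)))
theorem1p2 k 2≤k = conclusion 2≤k (⌊√⌋-spec (2 * k ∸ 3))
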